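{- Let $k,n,m\ge1$ be integers and let $A\in\mathbb Z^{n\times m}$ be any $k$-monotone matrix. Then $$\mathrm{lindisc}(A)\le 5k\cdot\log_2\big(2\min\{n,m\}\big).$$
   Context: A matrix $A$ with $n$ rows and $m$ columns is $k$-monotone if $A\in\{0,1,\dots,k\}^{n\times m}$ and $A_{1j}\le A_{2j}\le\dots\le A_{nj}$ for every column $j$. The linear discrepancy of $A\in\mathbb R^{n\times m}$ is $$\mathrm{lindisc}(A)=\max_{y\in[0,1]^m}\ \min_{x\in\{0,1\}^m}\|Ax-Ay\|_\infty .$$ -}

module Defs where

open import Data.Fin as Fin using (Fin)
import Data.Fin.Properties as Finₚ
open import Data.Integer as ℤ using (ℤ; +_)
import Data.Integer.Properties as ℤₚ
open import Data.Nat as ℕ using (ℕ; zero; suc)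
import Data.Nat.Properties as ℕₚ
open import Data.Nat.Logarithm
open import Data.Product using (Σ; ∃; _×_; _,_; proj₁; proj₂)
open import Data.Rational as ℚ using (ℚ; 0ℚ; 1ℚ; ½)
import Data.Rational.Properties as ℚₚ
import Data.Rational.Unnormalised as ℚᵘ
import Data.Rational.Unnormalised.Properties as ℚᵘₚ
open import Data.Sum using (inj₁; inj₂; [_,_]′)
open import Data.Vec using (Vec; []; _∷_; foldr′; lookup; map; replicate; zipWith)
open import Data.Vec.Relation.Binary.Pointwise.Inductive as Pointwise using (Pointwise; []; _∷_)
open import Data.Vec.Relation.Unary.All using (All; []; _∷_)
open import Function using (_∘_; _⇔_; mk⇔)
open import Relation.Binary.PropositionalEquality
open import Relation.Nullary using (yes; no; contradiction)
open import Relation.Nullary.Decidable using (dec⇒maybe)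
open import Tactic.RingSolver using (solve-∀)
open import Tactic.RingSolver.Core.AlmostCommutativeRing using (AlmostCommutativeRing; fromCommutativeRing)

module RationalLemmas where
  open import Data.Rational
  open import Data.Rational.Properties

  ring : AlmostCommutativeRing _ _
  ring = fromCommutativeRing +-*-commutativeRing (λ x → dec⇒maybe (0ℚ ≟ x))

  ½+½ : ∀ p → ½ * p + ½ * p ≡ p
  ½+½ = solve-∀ ring

  telescope : ∀ p q r → (p - q) + (q - r) ≡ p - r
  telescope = solve-∀ ring

  [p-q]+q : ∀ p q → (p - q) + q ≡ p
  [p-q]+q = solve-∀ ring

  [p+q]-p : ∀ p q → (p + q) - p ≡ q
  [p+q]-p = solve-∀ ring

  neg-sub : ∀ p q → - (p - q) ≡ q - p
  neg-sub = solve-∀ ring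

  0<½* : ∀ {ε} → 0ℚ < ε → 0ℚ < ½ * ε
  0<½* 0<ε = *-monoʳ-<-pos ½ 0<ε

  ≤+nonneg : ∀ p {c} → 0ℚ ≤ c → p ≤ p + c
  ≤+nonneg p 0≤c = subst (_≤ p + _) (+-identityʳ p) (+-monoʳ-≤ p 0≤c)

  +nonneg : ∀ {p q} → 0ℚ ≤ p → 0ℚ ≤ q → 0ℚ ≤ p + q
  +nonneg 0≤p 0≤q = +-mono-≤ 0≤p 0≤q

  *nonneg : ∀ {p q} → 0ℚ ≤ p → 0ℚ ≤ q → 0ℚ ≤ p * q
  *nonneg {p} {q} 0≤p 0≤q =
    subst (_≤ p * q) (*-zeroʳ p) (*-monoˡ-≤-nonNeg p {{nonNegative 0≤p}} 0≤q)

  *-mono-≤-nonneg : ∀ {p q r s} → 0ℚ ≤ r → 0ℚ ≤ q → p ≤ q → r ≤ s → p * r ≤ q * s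
  *-mono-≤-nonneg {q = q} {r} 0≤r 0≤q p≤q r≤s =
    ≤-trans (*-monoʳ-≤-nonNeg r {{nonNegative 0≤r}} p≤q)
            (*-monoˡ-≤-nonNeg q {{nonNegative 0≤q}} r≤s)

  p≤∣p∣ : ∀ p → p ≤ ∣ p ∣
  p≤∣p∣ p with ≤-total 0ℚ p
  ... | inj₁ 0≤p = ≤-reflexive (sym (0≤p⇒∣p∣≡p 0≤p))
  ... | inj₂ p≤0 = ≤-trans p≤0 (0≤∣p∣ p)

  ∣p∣≤ : ∀ {p c} → p ≤ c → - p ≤ c → ∣ p ∣ ≤ c
  ∣p∣≤ {p} p≤c -p≤c with ∣p∣≡p∨∣p∣≡-p p
  ... | inj₁ eq = subst (_≤ _) (sym eq) p≤c
  ... | inj₂ eq = subst (_≤ _) (sym eq) -p≤c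

  dist-comm : ∀ p q → ∣ p - q ∣ ≡ ∣ q - p ∣
  dist-comm p q = trans (sym (∣-p∣≡∣p∣ (p - q))) (cong ∣_∣ (neg-sub p q))

  dist-triangle : ∀ p q r → ∣ p - r ∣ ≤ ∣ p - q ∣ + ∣ q - r ∣
  dist-triangle p q r =
    subst (λ x → ∣ x ∣ ≤ ∣ p - q ∣ + ∣ q - r ∣) (telescope p q r) (∣p+q∣≤∣p∣+∣q∣ (p - q) (q - r))

  p≤q+∣p-q∣ : ∀ p q → p ≤ q + ∣ p - q ∣
  p≤q+∣p-q∣ p q = begin
    p              ≡⟨ [p-q]+q p q ⟨
    (p - q) + q    ≤⟨ +-monoˡ-≤ q (p≤∣p∣ (p - q)) ⟩
    ∣ p - q ∣ + q  ≡⟨ +-comm ∣ p - q ∣ q ⟩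
    q + ∣ p - q ∣  ∎
    where open ≤-Reasoning

  ≤+⇒-≤ : ∀ {p q c} → p ≤ q + c → p - q ≤ c
  ≤+⇒-≤ {p} {q} {c} p≤q+c = subst (p - q ≤_) ([p+q]-p q c) (+-monoˡ-≤ (- q) p≤q+c)

  dist≤ : ∀ {p q c} → p ≤ q + c → q ≤ p + c → ∣ p - q ∣ ≤ c
  dist≤ {p} {q} {c} p≤q+c q≤p+c =
    ∣p∣≤ (≤+⇒-≤ p≤q+c) (subst (_≤ c) (sym (neg-sub p q)) (≤+⇒-≤ q≤p+c))

  dist≤⇒≤+ : ∀ {p q c} → ∣ p - q ∣ ≤ c → p ≤ q + c
  dist≤⇒≤+ {p} {q} d = ≤-trans (p≤q+∣p-q∣ p q) (+-monoʳ-≤ q d)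

  dist-refl : ∀ p → ∣ p - p ∣ ≡ 0ℚ
  dist-refl p = cong ∣_∣ (+-inverseʳ p)

  NonExpansive₁ : (ℚ → ℚ) → Set
  NonExpansive₁ f = ∀ p q → ∣ f p - f q ∣ ≤ ∣ p - q ∣

  NonExpansive₂ : (ℚ → ℚ → ℚ) → Set
  NonExpansive₂ _∙_ = ∀ p q p′ q′ → ∣ (p ∙ q) - (p′ ∙ q′) ∣ ≤ ∣ p - p′ ∣ + ∣ q - q′ ∣

  ∣∣-nonexpansive : NonExpansive₁ ∣_∣
  ∣∣-nonexpansive p q = dist≤ (bound p q)
    (subst (λ d → ∣ q ∣ ≤ ∣ p ∣ + d) (dist-comm q p) (bound q p))
    where
    bound : ∀ p q → ∣ p ∣ ≤ ∣ q ∣ + ∣ p - q ∣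
    bound p q = begin
      ∣ p ∣              ≡⟨ cong ∣_∣ ([p-q]+q p q) ⟨
      ∣ (p - q) + q ∣    ≤⟨ ∣p+q∣≤∣p∣+∣q∣ (p - q) q ⟩
      ∣ p - q ∣ + ∣ q ∣  ≡⟨ +-comm ∣ p - q ∣ ∣ q ∣ ⟩
      ∣ q ∣ + ∣ p - q ∣  ∎
      where open ≤-Reasoning

  +-nonexpansive : NonExpansive₂ _+_
  +-nonexpansive p q p′ q′ =
    subst (λ x → ∣ x ∣ ≤ ∣ p - p′ ∣ + ∣ q - q′ ∣) (sym (shuffle p q p′ q′)) (∣p+q∣≤∣p∣+∣q∣ (p - p′) (q - q′))
    where
    shuffle : ∀ p q p′ q′ → (p + q) - (p′ + q′) ≡ (p - p′) + (q - q′)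
    shuffle = solve-∀ ring

  -‿nonexpansive : NonExpansive₂ _-_
  -‿nonexpansive p q p′ q′ =
    subst (λ x → ∣ x ∣ ≤ ∣ p - p′ ∣ + ∣ q - q′ ∣) (sym (shuffle p q p′ q′)) (∣p-q∣≤∣p∣+∣q∣ (p - p′) (q - q′))
    where
    shuffle : ∀ p q p′ q′ → (p - q) - (p′ - q′) ≡ (p - p′) - (q - q′)
    shuffle = solve-∀ ring

  module _ (_∙_ : ℚ → ℚ → ℚ)
           (bound : ∀ p q p′ q′ → (p ∙ q) ≤ (p′ ∙ q′) + (∣ p - p′ ∣ + ∣ q - q′ ∣)) where

    symmetric-bound⇒nonexpansive : NonExpansive₂ _∙_
    symmetric-bound⇒nonexpansive p q p′ q′ = dist≤ (bound p q p′ q′)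
      (subst₂ (λ d e → (p′ ∙ q′) ≤ (p ∙ q) + (d + e)) (dist-comm p′ p) (dist-comm q′ q)
              (bound p′ q′ p q))

  ≤+dist-left : ∀ p q p′ q′ → p ≤ p′ + (∣ p - p′ ∣ + ∣ q - q′ ∣)
  ≤+dist-left p q p′ q′ =
    ≤-trans (p≤q+∣p-q∣ p p′) (+-monoʳ-≤ p′ (≤+nonneg _ (0≤∣p∣ (q - q′))))

  ≤+dist-right : ∀ p q p′ q′ → q ≤ q′ + (∣ p - p′ ∣ + ∣ q - q′ ∣)
  ≤+dist-right p q p′ q′ =
    subst (λ d → q ≤ q′ + d) (+-comm ∣ q - q′ ∣ ∣ p - p′ ∣) (≤+dist-left q p q′ p′)

  ⊔-nonexpansive : NonExpansive₂ _⊔_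
  ⊔-nonexpansive = symmetric-bound⇒nonexpansive _⊔_ λ p q p′ q′ → ⊔-lub
    (≤-trans (≤+dist-left p q p′ q′) (+-monoˡ-≤ _ (p≤p⊔q p′ q′)))
    (≤-trans (≤+dist-right p q p′ q′) (+-monoˡ-≤ _ (p≤q⊔p p′ q′)))

  ⊓-nonexpansive : NonExpansive₂ _⊓_
  ⊓-nonexpansive = symmetric-bound⇒nonexpansive _⊓_ λ p q p′ q′ →
    let c = ∣ p - p′ ∣ + ∣ q - q′ ∣ in
    subst ((p ⊓ q) ≤_) (sym (mono-≤-distrib-⊓ {_+ c} (+-monoˡ-≤ c) p′ q′))
      (⊓-glb (≤-trans (p⊓q≤p p q) (≤+dist-left p q p′ q′))
             (≤-trans (p⊓q≤q p q) (≤+dist-right p q p′ q′)))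

  *-dist : ∀ p q p′ q′ → ∣ p * q - p′ * q′ ∣ ≤ ∣ p ∣ * ∣ q - q′ ∣ + ∣ q′ ∣ * ∣ p - p′ ∣
  *-dist p q p′ q′ = begin
    ∣ p * q - p′ * q′ ∣                        ≡⟨ cong ∣_∣ (split p q p′ q′) ⟩
    ∣ p * (q - q′) + q′ * (p - p′) ∣           ≤⟨ ∣p+q∣≤∣p∣+∣q∣ (p * (q - q′)) (q′ * (p - p′)) ⟩
    ∣ p * (q - q′) ∣ + ∣ q′ * (p - p′) ∣       ≡⟨ cong₂ _+_ (∣p*q∣≡∣p∣*∣q∣ p (q - q′)) (∣p*q∣≡∣p∣*∣q∣ q′ (p - p′)) ⟩
    ∣ p ∣ * ∣ q - q′ ∣ + ∣ q′ ∣ * ∣ p - p′ ∣   ∎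
    where
    open ≤-Reasoning
    split : ∀ p q p′ q′ → p * q - p′ * q′ ≡ p * (q - q′) + q′ * (p - p′)
    split = solve-∀ ring

  archimedean-≤ : ∀ {p q} → (∀ ε → 0ℚ < ε → p ≤ q + ε) → p ≤ q
  archimedean-≤ {p} {q} p≤q+ with p ≤? q
  ... | yes p≤q = p≤q
  ... | no p≰q =
    let q<p = ≰⇒> p≰q
        gap = subst (_< p - q) (+-inverseʳ q) (+-monoˡ-< (- q) q<p)
        mid = p≤q+ (½ * (p - q)) (0<½* gap)
        mid< : q + ½ * (p - q) < p
        mid< = subst₂ _<_ (+-identityʳ _) (recombine p q) (+-monoʳ-< (q + ½ * (p - q)) (0<½* gap))
    in contradiction (≤-<-trans mid mid<) (<-irrefl refl)
    where
    recombine : ∀ p q → (q + ½ * (p - q)) + ½ * (p - q) ≡ p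
    recombine = solve-∀ ring

  divide : ∀ B ε → 0ℚ < B → 0ℚ < ε → ∃ λ δ → 0ℚ < δ × B * δ ≡ ε
  divide B ε 0<B 0<ε = 1/B * ε
    , subst (_< 1/B * ε) (*-zeroʳ 1/B) (*-monoʳ-<-pos 1/B {{1/pos⇒pos B {{positive 0<B}}}} 0<ε)
    , trans (sym (*-assoc B 1/B ε)) (trans (cong (_* ε) (*-inverseʳ B {{B≢0}})) (*-identityˡ ε))
    where
    B≢0 = pos⇒nonZero B {{positive 0<B}}
    1/B = (1/ B) {{B≢0}}

  private
    toℚᵘ-/ : ∀ i d → toℚᵘ (i / suc d) ℚᵘ.≃ ℚᵘ.mkℚᵘ i d
    toℚᵘ-/ i d = toℚᵘ-fromℚᵘ (ℚᵘ.mkℚᵘ i d)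

  /-mono : ∀ i j c d → i ℤ.* + suc d ℤ.≤ j ℤ.* + suc c → i / suc c ≤ j / suc d
  /-mono i j c d le = toℚᵘ-cancel-≤
    (ℚᵘₚ.≤-respʳ-≃ (ℚᵘₚ.≃-sym (toℚᵘ-/ j d))
      (ℚᵘₚ.≤-respˡ-≃ (ℚᵘₚ.≃-sym (toℚᵘ-/ i c)) (ℚᵘ.*≤* le)))

  /ℕ-mono : ∀ a b c d → a ℕ.* suc d ℕ.≤ b ℕ.* suc c → + a / suc c ≤ + b / suc d
  /ℕ-mono a b c d le = /-mono (+ a) (+ b) c d
    (subst₂ ℤ._≤_ (ℤₚ.pos-* a (suc d)) (ℤₚ.pos-* b (suc c)) (ℤ.+≤+ le))

  /ℕ-+ : ∀ a b d → + (a ℕ.+ b) / suc d ≡ + a / suc d + + b / suc d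
  /ℕ-+ a b d = toℚᵘ-injective (ℚᵘₚ.≃-trans (toℚᵘ-/ (+ (a ℕ.+ b)) d) (ℚᵘₚ.≃-sym
    (ℚᵘₚ.≃-trans (toℚᵘ-homo-+ (+ a / suc d) (+ b / suc d))
      (ℚᵘₚ.≃-trans (ℚᵘₚ.+-cong (toℚᵘ-/ (+ a) d) (toℚᵘ-/ (+ b) d))
        (ℚᵘ.*≡* (same-denominator (+ a) (+ b) (+ suc d)))))))
    where
    open import Data.Integer.Tactic.RingSolver using () renaming (solve-∀ to ℤ-solve-∀)
    same-denominator : ∀ x y z → (x ℤ.* z ℤ.+ y ℤ.* z) ℤ.* z ≡ (x ℤ.+ y) ℤ.* (z ℤ.* z)
    same-denominator = ℤ-solve-∀

  /ℕ-+-≤ : ∀ a b e c d f → (a ℕ.* suc d ℕ.+ b ℕ.* suc c) ℕ.* suc f ℕ.≤ e ℕ.* (suc c ℕ.* suc d) →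
           + a / suc c + + b / suc d ≤ + e / suc f
  /ℕ-+-≤ a b e c d f le = toℚᵘ-cancel-≤
    (ℚᵘₚ.≤-respˡ-≃ (ℚᵘₚ.≃-sym (ℚᵘₚ.≃-trans (toℚᵘ-homo-+ (+ a / suc c) (+ b / suc d))
                                           (ℚᵘₚ.+-cong (toℚᵘ-/ (+ a) c) (toℚᵘ-/ (+ b) d))))
      (ℚᵘₚ.≤-respʳ-≃ (ℚᵘₚ.≃-sym (toℚᵘ-/ (+ e) f))
        (ℚᵘ.*≤* (subst₂ ℤ._≤_ lhs (ℤₚ.pos-* e (suc c ℕ.* suc d)) (ℤ.+≤+ le)))))
    where
    lhs : + ((a ℕ.* suc d ℕ.+ b ℕ.* suc c) ℕ.* suc f) ≡ (+ a ℤ.* + suc d ℤ.+ + b ℤ.* + suc c) ℤ.* + suc f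
    lhs = trans (ℤₚ.pos-* (a ℕ.* suc d ℕ.+ b ℕ.* suc c) (suc f))
            (cong (ℤ._* + suc f) (cong₂ ℤ._+_ (ℤₚ.pos-* a (suc d)) (ℤₚ.pos-* b (suc c))))

  0≤/ℕ : ∀ a d → 0ℚ ≤ + a / suc d
  0≤/ℕ a d = /ℕ-mono 0 a 0 d ℕ.z≤n

  0<1/suc : ∀ d → 0ℚ < + 1 / suc d
  0<1/suc d = positive⁻¹ (+ 1 / suc d) {{normalize-pos 1 (suc d)}}

  archimedean : ∀ ε → 0ℚ < ε → ∃ λ N → ∀ n → N ℕ.≤ n → + 1 / suc n ≤ ε
  archimedean (mkℚ (+ zero) d c) (*<* (ℤ.+<+ ()))
  archimedean (mkℚ ℤ.-[1+ a ] d c) (*<* ())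
  archimedean ε@(mkℚ (+ suc a) d c) _ = d , λ n d≤n →
    subst (+ 1 / suc n ≤_) (↥p/↧p≡p ε) (/ℕ-mono 1 (suc a) n d
      (ℕₚ.≤-trans (ℕₚ.≤-reflexive (ℕₚ.*-identityˡ (suc d)))
        (ℕₚ.≤-trans (ℕ.s≤s d≤n) (ℕₚ.m≤m+n (suc n) (a ℕ.* suc n)))))

  nearest : ∀ h → 0ℚ ≤ h → (point : ℕ → ℚ) → point 0 ≡ 0ℚ → (∀ k → point (suc k) ≡ point k + h) →
          ∀ k {q} → 0ℚ ≤ q + h → q ≤ point k + h → ∃ λ i → i ℕ.≤ k × ∣ q - point i ∣ ≤ h
  nearest h 0≤h point point-0 point-suc zero    {q} lo hi = 0 , ℕ.z≤n ,
    dist≤ hi (subst (_≤ q + h) (sym point-0) lo)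
  nearest h 0≤h point point-0 point-suc (suc k) {q} lo hi with point k ≤? q
  ... | yes k≤q = suc k , ℕₚ.≤-refl ,
    dist≤ hi (subst (_≤ q + h) (sym (point-suc k)) (+-monoˡ-≤ h k≤q))
  ... | no  k≰q =
    let i , i≤k , close = nearest h 0≤h point point-0 point-suc k lo
          (≤-trans (<⇒≤ (≰⇒> k≰q)) (≤+nonneg (point k) 0≤h))
    in i , ℕₚ.m≤n⇒m≤1+n i≤k , close

  nearestᶠ : ∀ h → 0ℚ ≤ h → (point : ℕ → ℚ) → point 0 ≡ 0ℚ → (∀ k → point (suc k) ≡ point k + h) →
             ∀ k {q} → 0ℚ ≤ q + h → q ≤ point k + h →
             ∃ λ (i : Fin (suc k)) → ∣ q - point (Fin.toℕ i) ∣ ≤ h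
  nearestᶠ h 0≤h point point-0 point-suc k {q} lo hi with nearest h 0≤h point point-0 point-suc k lo hi
  ... | i , i≤k , close = Fin.fromℕ< (ℕ.s≤s i≤k) ,
    subst (λ j → ∣ q - point j ∣ ≤ h) (sym (Finₚ.toℕ-fromℕ< (ℕ.s≤s i≤k))) close

open RationalLemmas

module LogarithmLemmas where
  open import Data.Nat
  open import Data.Nat.Properties
  open import Data.Nat.Induction using (<-rec)
  open ≤-Reasoning

  2*⌊n/2⌋≤n : ∀ n → 2 * ⌊ n /2⌋ ≤ n
  2*⌊n/2⌋≤n n = begin
    2 * ⌊ n /2⌋           ≡⟨ cong (λ x → ⌊ n /2⌋ + x) (+-identityʳ ⌊ n /2⌋) ⟩
    ⌊ n /2⌋ + ⌊ n /2⌋     ≤⟨ +-monoʳ-≤ ⌊ n /2⌋ (⌊n/2⌋≤⌈n/2⌉ n) ⟩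
    ⌊ n /2⌋ + ⌈ n /2⌉     ≡⟨ ⌊n/2⌋+⌈n/2⌉≡n n ⟩
    n                     ∎

  2^⌊log₂n⌋≤n : ∀ n .{{_ : NonZero n}} → 2 ^ ⌊log₂ n ⌋ ≤ n
  2^⌊log₂n⌋≤n = <-rec (λ n → .{{_ : NonZero n}} → 2 ^ ⌊log₂ n ⌋ ≤ n) λ where
    1               rec → s≤s z≤n
    n@(suc (suc m)) rec → begin
      2 ^ ⌊log₂ n ⌋                 ≡⟨ cong (2 ^_) (m+[n∸m]≡n {1} (⌊log₂⌋-mono-≤ {2} {n} (s≤s (s≤s z≤n)))) ⟨
      2 * 2 ^ (⌊log₂ n ⌋ ∸ 1)       ≡⟨ cong (λ l → 2 * 2 ^ l) (⌊log₂⌊n/2⌋⌋≡⌊log₂n⌋∸1 n) ⟨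
      2 * 2 ^ ⌊log₂ ⌊ n /2⌋ ⌋       ≤⟨ *-monoʳ-≤ 2 (rec (⌊n/2⌋<n (suc m))) ⟩
      2 * ⌊ n /2⌋                   ≤⟨ 2*⌊n/2⌋≤n n ⟩
      n                             ∎

  n<2^[1+⌊log₂n⌋] : ∀ n → n < 2 ^ suc ⌊log₂ n ⌋
  n<2^[1+⌊log₂n⌋] n = ≰⇒> λ le → 1+n≰n
    (≤-trans (≤-reflexive (sym (⌊log₂[2^n]⌋≡n (suc ⌊log₂ n ⌋)))) (⌊log₂⌋-mono-≤ le))

  2^-cancel-< : ∀ {a b} → 2 ^ a < 2 ^ b → a < b
  2^-cancel-< lt = ≰⇒> λ b≤a → <⇒≱ lt (^-monoʳ-≤ 2 b≤a)

  ^-swap : ∀ b c d → (b ^ c) ^ d ≡ (b ^ d) ^ c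
  ^-swap b c d = trans (^-*-assoc b c d) (trans (cong (b ^_) (*-comm c d)) (sym (^-*-assoc b d c)))

  ^-distribʳ-* : ∀ a b c → (a * b) ^ c ≡ a ^ c * b ^ c
  ^-distribʳ-* a b zero    = refl
  ^-distribʳ-* a b (suc c) = trans (cong (a * b *_) (^-distribʳ-* a b c))
    ([m*n]*[o*p]≡[m*o]*[n*p] a b (a ^ c) (b ^ c))

  -- The lower approximation ⌊log₂ Nʲ⌋ / j is below the upper approximation (1 + ⌊log₂ Nⁱ⌋) / i.
  log-approximations : ∀ N i j →
    ⌊log₂ (N ^ suc j) ⌋ * suc i ≤ suc ⌊log₂ (N ^ suc i) ⌋ * suc j
  log-approximations zero      i j = z≤n
  log-approximations N@(suc _) i j = <⇒≤ (2^-cancel-< (begin-strict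
    2 ^ (a * suc i)          ≡⟨ ^-*-assoc 2 a (suc i) ⟨
    (2 ^ a) ^ suc i          ≤⟨ ^-monoˡ-≤ (suc i) (2^⌊log₂n⌋≤n (N ^ suc j) {{m^n≢0 N (suc j)}}) ⟩
    (N ^ suc j) ^ suc i      ≡⟨ ^-swap N (suc j) (suc i) ⟩
    (N ^ suc i) ^ suc j      <⟨ ^-monoˡ-< (suc j) (n<2^[1+⌊log₂n⌋] (N ^ suc i)) ⟩
    (2 ^ suc b) ^ suc j      ≡⟨ ^-*-assoc 2 (suc b) (suc j) ⟩
    2 ^ (suc b * suc j)      ∎))
    where
    a = ⌊log₂ (N ^ suc j) ⌋
    b = ⌊log₂ (N ^ suc i) ⌋

  bernoulli : ∀ M t → (M + t) * M ^ t ≤ M * suc M ^ t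
  bernoulli M zero    = ≤-reflexive (cong (_* 1) (+-identityʳ M))
  bernoulli M (suc t) = begin
    (M + suc t) * (M * M ^ t)        ≡⟨ lhs M t (M ^ t) ⟩
    (M * (M + t) + M) * M ^ t        ≤⟨ *-monoˡ-≤ (M ^ t) (+-monoʳ-≤ (M * (M + t)) (m≤m+n M t)) ⟩
    (M * (M + t) + (M + t)) * M ^ t  ≡⟨ mid M t (M ^ t) ⟩
    suc M * ((M + t) * M ^ t)        ≤⟨ *-monoʳ-≤ (suc M) (bernoulli M t) ⟩
    suc M * (M * suc M ^ t)          ≡⟨ rhs M (suc M ^ t) ⟩
    M * (suc M * suc M ^ t)          ∎
    where
    open import Data.Nat.Tactic.RingSolver using () renaming (solve-∀ to ℕ-solve-∀)
    lhs : ∀ M t p → (M + suc t) * (M * p) ≡ (M * (M + t) + M) * p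
    lhs = ℕ-solve-∀
    mid : ∀ M t p → (M * (M + t) + (M + t)) * p ≡ suc M * ((M + t) * p)
    mid = ℕ-solve-∀
    rhs : ∀ M p → suc M * (M * p) ≡ M * (suc M * p)
    rhs = ℕ-solve-∀

  2*M^M≤[1+M]^M : ∀ M .{{_ : NonZero M}} → 2 * M ^ M ≤ suc M ^ M
  2*M^M≤[1+M]^M M = *-cancelˡ-≤ M (begin
    M * (2 * M ^ M)      ≡⟨ *-assoc M 2 (M ^ M) ⟨
    (M * 2) * M ^ M      ≡⟨ cong (_* M ^ M) (trans (*-comm M 2) (cong (λ x → M + x) (+-identityʳ M))) ⟩
    (M + M) * M ^ M      ≤⟨ bernoulli M M ⟩
    M * suc M ^ M        ∎)

open LogarithmLemmas

-- Real numbers are Cauchy sequences of rationals carrying their modulus.  They are compared by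
-- _≤_ rather than quotiented; two of them are equal as real numbers when each is ≤ the other.

record ℝ : Set where
  no-eta-equality
  field
    seq    : ℕ → ℚ
    cauchy : ∀ ε → 0ℚ ℚ.< ε → ∃ λ N → ∀ i j → N ℕ.≤ i → N ℕ.≤ j → ℚ.∣ seq i ℚ.- seq j ∣ ℚ.≤ ε

open ℝ public

infix 4 _≤_

record _≤_ (x y : ℝ) : Set where
  no-eta-equality
  constructor *≤*
  field eventually : ∀ ε → 0ℚ ℚ.< ε → ∃ λ N → ∀ n → N ℕ.≤ n → seq x n ℚ.≤ seq y n ℚ.+ ε

open _≤_ public

fromℚ : ℚ → ℝ
fromℚ p .seq _ = p
fromℚ p .cauchy ε 0<ε = 0 , λ _ _ _ _ → subst (ℚ._≤ ε) (sym (dist-refl p)) (ℚₚ.<⇒≤ 0<ε)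

fromℤ : ℤ → ℝ
fromℤ i = fromℚ (i ℚ./ 1)

fromℕ : ℕ → ℝ
fromℕ n = fromℤ (+ n)

lift₁ : (f : ℚ → ℚ) → NonExpansive₁ f → ℝ → ℝ
lift₁ f f-ne x .seq n = f (seq x n)
lift₁ f f-ne x .cauchy ε 0<ε =
  let N , close = cauchy x ε 0<ε
  in N , λ i j N≤i N≤j → ℚₚ.≤-trans (f-ne (seq x i) (seq x j)) (close i j N≤i N≤j)

lift₂ : (_∙_ : ℚ → ℚ → ℚ) → NonExpansive₂ _∙_ → ℝ → ℝ → ℝ
lift₂ _∙_ ∙-ne x y .seq n = seq x n ∙ seq y n
lift₂ _∙_ ∙-ne x y .cauchy ε 0<ε =
      let N , x-close = cauchy x (½ ℚ.* ε) (0<½* 0<ε)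
          M , y-close = cauchy y (½ ℚ.* ε) (0<½* 0<ε)
      in N ℕ.⊔ M , λ i j ≤i ≤j → ℚₚ.≤-trans
           (∙-ne (seq x i) (seq y i) (seq x j) (seq y j))
           (subst (_ ℚ.≤_) (½+½ ε) (ℚₚ.+-mono-≤
             (x-close i j (ℕₚ.m⊔n≤o⇒m≤o N M ≤i) (ℕₚ.m⊔n≤o⇒m≤o N M ≤j))
             (y-close i j (ℕₚ.m⊔n≤o⇒n≤o N M ≤i) (ℕₚ.m⊔n≤o⇒n≤o N M ≤j))))

infixl 6 _+_ _-_ _⊔_
infixl 7 _*_ _⊓_

_+_ _-_ _⊔_ _⊓_ : ℝ → ℝ → ℝ
_+_ = lift₂ ℚ._+_ +-nonexpansive
_-_ = lift₂ ℚ._-_ -‿nonexpansive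
_⊔_ = lift₂ ℚ._⊔_ ⊔-nonexpansive
_⊓_ = lift₂ ℚ._⊓_ ⊓-nonexpansive

∣_∣ : ℝ → ℝ
∣_∣ = lift₁ ℚ.∣_∣ ∣∣-nonexpansive

bounded : ∀ x → ∃ λ B → 0ℚ ℚ.< B × ∃ λ N → ∀ n → N ℕ.≤ n → ℚ.∣ seq x n ∣ ℚ.≤ B
bounded x =
  let N , close = cauchy x 1ℚ (ℚₚ.positive⁻¹ 1ℚ)
      c         = ℚ.∣ seq x N ∣
  in c ℚ.+ 1ℚ , ℚₚ.+-mono-≤-< (ℚₚ.0≤∣p∣ (seq x N)) (ℚₚ.positive⁻¹ 1ℚ) , N , λ n N≤n →
       dist≤⇒≤+ {ℚ.∣ seq x n ∣} {c}
         (ℚₚ.≤-trans (∣∣-nonexpansive (seq x n) (seq x N)) (close n N N≤n ℕₚ.≤-refl))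

_*_ : ℝ → ℝ → ℝ
(x * y) .seq n = seq x n ℚ.* seq y n
(x * y) .cauchy ε 0<ε =
      let B , 0<B , N₁ , x-bound = bounded x
          C , 0<C , N₂ , y-bound = bounded y
          δ , 0<δ , Bδ           = divide B (½ ℚ.* ε) 0<B (0<½* 0<ε)
          η , 0<η , Cη           = divide C (½ ℚ.* ε) 0<C (0<½* 0<ε)
          N₃ , x-close           = cauchy x η 0<η
          N₄ , y-close           = cauchy y δ 0<δ
          N                      = (N₁ ℕ.⊔ N₂) ℕ.⊔ (N₃ ℕ.⊔ N₄)
          N₁≤ = ℕₚ.≤-trans (ℕₚ.m≤m⊔n N₁ N₂) (ℕₚ.m≤m⊔n (N₁ ℕ.⊔ N₂) (N₃ ℕ.⊔ N₄))
          N₂≤ = ℕₚ.≤-trans (ℕₚ.m≤n⊔m N₁ N₂) (ℕₚ.m≤m⊔n (N₁ ℕ.⊔ N₂) (N₃ ℕ.⊔ N₄))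
          N₃≤ = ℕₚ.≤-trans (ℕₚ.m≤m⊔n N₃ N₄) (ℕₚ.m≤n⊔m (N₁ ℕ.⊔ N₂) (N₃ ℕ.⊔ N₄))
          N₄≤ = ℕₚ.≤-trans (ℕₚ.m≤n⊔m N₃ N₄) (ℕₚ.m≤n⊔m (N₁ ℕ.⊔ N₂) (N₃ ℕ.⊔ N₄))
      in N , λ i j N≤i N≤j → ℚₚ.≤-trans
           (*-dist (seq x i) (seq y i) (seq x j) (seq y j))
           (subst (_ ℚ.≤_) (trans (cong₂ ℚ._+_ Bδ Cη) (½+½ ε)) (ℚₚ.+-mono-≤
             (*-mono-≤-nonneg (ℚₚ.0≤∣p∣ _) (ℚₚ.<⇒≤ 0<B) (x-bound i (ℕₚ.≤-trans N₁≤ N≤i))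
               (y-close i j (ℕₚ.≤-trans N₄≤ N≤i) (ℕₚ.≤-trans N₄≤ N≤j)))
             (*-mono-≤-nonneg (ℚₚ.0≤∣p∣ _) (ℚₚ.<⇒≤ 0<C) (y-bound j (ℕₚ.≤-trans N₂≤ N≤j))
               (x-close i j (ℕₚ.≤-trans N₃≤ N≤i) (ℕₚ.≤-trans N₃≤ N≤j)))))

module RealLemmas where

  eventually≤ : ∀ {x y} N → (∀ n → N ℕ.≤ n → seq x n ℚ.≤ seq y n) → x ≤ y
  eventually≤ {x} {y} N le .eventually ε 0<ε = N , λ n N≤n →
    ℚₚ.≤-trans (le n N≤n) (≤+nonneg (seq y n) (ℚₚ.<⇒≤ 0<ε))

  pointwise≤ : ∀ {x y} → (∀ n → seq x n ℚ.≤ seq y n) → x ≤ y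
  pointwise≤ le = eventually≤ 0 λ n _ → le n

  ≤-refl : ∀ {x} → x ≤ x
  ≤-refl = pointwise≤ λ _ → ℚₚ.≤-refl

  split-ε : ∀ p ε → (p ℚ.+ ½ ℚ.* ε) ℚ.+ ½ ℚ.* ε ≡ p ℚ.+ ε
  split-ε = solve-∀ ring

  split-ε₂ : ∀ p q ε → (p ℚ.+ ½ ℚ.* ε) ℚ.+ (q ℚ.+ ½ ℚ.* ε) ≡ (p ℚ.+ q) ℚ.+ ε
  split-ε₂ = solve-∀ ring

  ≤-trans : ∀ {x y z} → x ≤ y → y ≤ z → x ≤ z
  ≤-trans {x} {y} {z} x≤y y≤z .eventually ε 0<ε =
    let N , p = eventually x≤y (½ ℚ.* ε) (0<½* 0<ε)
        M , q = eventually y≤z (½ ℚ.* ε) (0<½* 0<ε)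
    in N ℕ.⊔ M , λ n ≤n → subst (seq x n ℚ.≤_) (split-ε (seq z n) ε)
         (ℚₚ.≤-trans (p n (ℕₚ.m⊔n≤o⇒m≤o N M ≤n))
           (ℚₚ.+-monoˡ-≤ (½ ℚ.* ε) (q n (ℕₚ.m⊔n≤o⇒n≤o N M ≤n))))

  +-mono-≤ : ∀ {x y z w} → x ≤ y → z ≤ w → x + z ≤ y + w
  +-mono-≤ {x} {y} {z} {w} x≤y z≤w .eventually ε 0<ε =
    let N , p = eventually x≤y (½ ℚ.* ε) (0<½* 0<ε)
        M , q = eventually z≤w (½ ℚ.* ε) (0<½* 0<ε)
    in N ℕ.⊔ M , λ n ≤n → subst (_ ℚ.≤_) (split-ε₂ (seq y n) (seq w n) ε)
         (ℚₚ.+-mono-≤ (p n (ℕₚ.m⊔n≤o⇒m≤o N M ≤n)) (q n (ℕₚ.m⊔n≤o⇒n≤o N M ≤n)))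

  *-monoˡ-≤ : ∀ {x y} B → 0ℚ ℚ.< B → x ≤ y → fromℚ B * x ≤ fromℚ B * y
  *-monoˡ-≤ {x} {y} B 0<B x≤y .eventually ε 0<ε =
    let δ , 0<δ , Bδ = divide B ε 0<B 0<ε
        N , p        = eventually x≤y δ 0<δ
    in N , λ n N≤n → subst (B ℚ.* seq x n ℚ.≤_)
         (trans (ℚₚ.*-distribˡ-+ B (seq y n) δ) (cong (B ℚ.* seq y n ℚ.+_) Bδ))
         (ℚₚ.*-monoˡ-≤-nonNeg B {{ℚ.nonNegative (ℚₚ.<⇒≤ 0<B)}} (p n N≤n))

  fromℚ-mono : ∀ {p q} → p ℚ.≤ q → fromℚ p ≤ fromℚ q
  fromℚ-mono p≤q = pointwise≤ λ _ → p≤q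

  fromℚ-cancel : ∀ {p q} → fromℚ p ≤ fromℚ q → p ℚ.≤ q
  fromℚ-cancel p≤q = archimedean-≤ λ ε 0<ε → let N , le = eventually p≤q ε 0<ε in le N ℕₚ.≤-refl

  ≤-archimedean : ∀ {x y} → (∀ ε → 0ℚ ℚ.< ε → x ≤ y + fromℚ ε) → x ≤ y
  ≤-archimedean {x} {y} le .eventually ε 0<ε =
    let N , p = eventually (le (½ ℚ.* ε) (0<½* 0<ε)) (½ ℚ.* ε) (0<½* 0<ε)
    in N , λ n N≤n → subst (seq x n ℚ.≤_) (split-ε (seq y n) ε) (p n N≤n)

  dist≤⇒≤+ʳ : ∀ {x y c} → ∣ x - y ∣ ≤ c → x ≤ y + c
  dist≤⇒≤+ʳ {x} {y} d =
    ≤-trans (pointwise≤ λ n → p≤q+∣p-q∣ (seq x n) (seq y n)) (+-mono-≤ ≤-refl d)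

  dist-commʳ : ∀ {x y c} → ∣ x - y ∣ ≤ c → ∣ y - x ∣ ≤ c
  dist-commʳ {x} {y} d = ≤-trans
    (pointwise≤ λ n → ℚₚ.≤-reflexive (dist-comm (seq y n) (seq x n))) d

  -- Here and below, *≤* (eventually p) recasts p between reals whose terms coincide, such as
  -- fromℚ c + fromℚ d and fromℚ (c ℚ.+ d).
  dist-triangleʳ : ∀ {x y z c d} → ∣ x - y ∣ ≤ fromℚ c → ∣ y - z ∣ ≤ fromℚ d →
                   ∣ x - z ∣ ≤ fromℚ (c ℚ.+ d)
  dist-triangleʳ {x} {y} {z} p q =
    *≤* (eventually (≤-trans {∣ x - z ∣} (pointwise≤ λ n → dist-triangle (seq x n) (seq y n) (seq z n))
                             (+-mono-≤ p q)))

  fromℚ-dist : ∀ {p q c} → ℚ.∣ p ℚ.- q ∣ ℚ.≤ c → ∣ fromℚ p - fromℚ q ∣ ≤ fromℚ c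
  fromℚ-dist d = pointwise≤ λ _ → d

  approx : ∀ (x : ℝ) ε → 0ℚ ℚ.< ε → ℚ
  approx x ε 0<ε = seq x (proj₁ (cauchy x ε 0<ε))

  approx-close : ∀ x ε 0<ε → ∣ x - fromℚ (approx x ε 0<ε) ∣ ≤ fromℚ ε
  approx-close x ε 0<ε = let N , close = cauchy x ε 0<ε in
    eventually≤ N λ n N≤n → close n N N≤n ℕₚ.≤-refl

open RealLemmas

-- s is the supremum of the values f y with y in D.
IsSupOn : {X : Set} → (X → Set) → (X → ℝ) → ℝ → Set
IsSupOn {X} D f s = (∀ y → D y → f y ≤ s) × (∀ b → (∀ y → D y → f y ≤ b) → s ≤ b)

fold⁺ : {C : Set} → (C → C → C) → ∀ {d} → (Fin (suc d) → C) → C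
fold⁺ _∙_ {zero}  f = f Fin.zero
fold⁺ _∙_ {suc d} f = f Fin.zero ∙ fold⁺ _∙_ (f ∘ Fin.suc)

-- Folds over all vectors with entries in {0, …, d}.
foldᵛ⁺ : {C : Set} → (C → C → C) → ∀ {d m} → (Vec (Fin (suc d)) m → C) → C
foldᵛ⁺ _∙_ {m = zero}  f = f []
foldᵛ⁺ _∙_ {m = suc m} f = fold⁺ _∙_ λ i → foldᵛ⁺ _∙_ λ v → f (i ∷ v)

[0,1] : ℝ → Set
[0,1] t = fromℕ 0 ≤ t × t ≤ fromℕ 1

[0,1]^ : ∀ m → Vec ℝ m → Set
[0,1]^ m = All [0,1]

Near : ∀ {m} → ℚ → Vec ℝ m → Vec ℝ m → Set
Near δ = Pointwise λ a b → ∣ a - b ∣ ≤ fromℚ δ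

Lipschitz : ∀ {m} → (Vec ℝ m → ℝ) → Set
Lipschitz f = ∃ λ L → 0ℚ ℚ.≤ L × (∀ {y z} δ → 0ℚ ℚ.≤ δ → Near δ y z → ∣ f y - f z ∣ ≤ fromℚ (L ℚ.* δ))

-- The supremum of a Lipschitz function over the unit cube: the n-th term is the largest of its
-- values, up to 1/(n+1), at the points with coordinates in {0, 1/(n+1), …, 1}.
module Supremum {m} (f : Vec ℝ m → ℝ) (lipschitz : Lipschitz f) where

  private
    L : ℚ
    L = proj₁ lipschitz

    0≤L : 0ℚ ℚ.≤ L
    0≤L = proj₁ (proj₂ lipschitz)

  step : ℕ → ℚ
  step n = + 1 ℚ./ suc n

  gridPoint : ∀ n → Fin (suc (suc n)) → ℝ
  gridPoint n i = fromℚ (+ Fin.toℕ i ℚ./ suc n)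

  grid : ∀ {l} n → Vec (Fin (suc (suc n))) l → Vec ℝ l
  grid n = map (gridPoint n)

  value : ∀ n → Vec (Fin (suc (suc n))) m → ℚ
  value n v = approx (f (grid n v)) (step n) (0<1/suc n)

  maximum : ℕ → ℚ
  maximum n = foldᵛ⁺ ℚ._⊔_ (value n)

  private
    0≤step : ∀ n → 0ℚ ℚ.≤ step n
    0≤step n = 0≤/ℕ 1 n

    suc/ : ∀ k n → + suc k ℚ./ suc n ≡ + k ℚ./ suc n ℚ.+ step n
    suc/ k n = trans (cong (λ a → + a ℚ./ suc n) (sym (ℕₚ.+-comm k 1))) (/ℕ-+ k 1 n)

    n/n : ∀ n → + suc n ℚ./ suc n ≡ 1ℚ
    n/n n = ℚₚ.≤-antisym (/ℕ-mono (suc n) 1 n 0 (ℕₚ.≤-reflexive (ℕₚ.*-comm (suc n) 1)))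
                         (/ℕ-mono 1 (suc n) 0 n (ℕₚ.≤-reflexive (ℕₚ.*-comm 1 (suc n))))

    grid∈cube : ∀ {l} n (v : Vec (Fin (suc (suc n))) l) → [0,1]^ l (grid n v)
    grid∈cube n []      = []
    grid∈cube n (i ∷ v) =
      ( fromℚ-mono {0ℚ} {+ Fin.toℕ i ℚ./ suc n} (0≤/ℕ (Fin.toℕ i) n)
      , fromℚ-mono {+ Fin.toℕ i ℚ./ suc n} {1ℚ} (/ℕ-mono (Fin.toℕ i) 1 n 0
          (ℕₚ.≤-trans (ℕₚ.≤-reflexive (ℕₚ.*-identityʳ (Fin.toℕ i)))
            (ℕₚ.≤-trans (ℕ.s≤s⁻¹ (Finₚ.toℕ<n i)) (ℕₚ.≤-reflexive (sym (ℕₚ.*-identityˡ (suc n))))))) )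
      ∷ grid∈cube n v

    2step : ℕ → ℚ
    2step n = step n ℚ.+ step n

    roundʳ : ∀ n y → [0,1] y → ∃ λ i → ∣ y - gridPoint n i ∣ ≤ fromℚ (2step n)
    roundʳ n y (0≤y , y≤1) =
      let q     = approx y (step n) (0<1/suc n)
          close = approx-close y (step n) (0<1/suc n)
          lo    = fromℚ-cancel {0ℚ} {q ℚ.+ step n}
                    (*≤* (eventually (≤-trans 0≤y (dist≤⇒≤+ʳ close))))
          hi    = fromℚ-cancel {q} {1ℚ ℚ.+ step n}
                    (*≤* (eventually (≤-trans (dist≤⇒≤+ʳ (dist-commʳ close)) (+-mono-≤ y≤1 ≤-refl))))
          i , near = nearestᶠ (step n) (0≤step n) (λ k → + k ℚ./ suc n) (ℚₚ.0/n≡0 (suc n)) (λ k → suc/ k n) (suc n) lo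
                            (subst (λ c → q ℚ.≤ c ℚ.+ step n) (sym (n/n n)) hi)
      in i , dist-triangleʳ close
           (fromℚ-dist {q} {+ Fin.toℕ i ℚ./ suc n} near)

    roundᵛ : ∀ {l} n (y : Vec ℝ l) → [0,1]^ l y → ∃ λ v → Near (2step n) y (grid n v)
    roundᵛ n []      []       = [] , []
    roundᵛ n (t ∷ y) (p ∷ ps) =
      let i , near  = roundʳ n t p
          v , nears = roundᵛ n y ps
      in i ∷ v , near ∷ nears

    fold⁺-⊔-upper : ∀ {d} (g : Fin (suc d) → ℚ) i → g i ℚ.≤ fold⁺ ℚ._⊔_ g
    fold⁺-⊔-upper {zero}  g Fin.zero    = ℚₚ.≤-refl
    fold⁺-⊔-upper {suc d} g Fin.zero    = ℚₚ.p≤p⊔q (g Fin.zero) (fold⁺ ℚ._⊔_ (g ∘ Fin.suc))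
    fold⁺-⊔-upper {suc d} g (Fin.suc i) = ℚₚ.≤-trans (fold⁺-⊔-upper (g ∘ Fin.suc) i)
                                            (ℚₚ.p≤q⊔p (g Fin.zero) (fold⁺ ℚ._⊔_ (g ∘ Fin.suc)))

    foldᵛ⁺-⊔-upper : ∀ {d l} (g : Vec (Fin (suc d)) l → ℚ) v → g v ℚ.≤ foldᵛ⁺ ℚ._⊔_ g
    foldᵛ⁺-⊔-upper g []      = ℚₚ.≤-refl
    foldᵛ⁺-⊔-upper g (i ∷ v) = ℚₚ.≤-trans (foldᵛ⁺-⊔-upper (λ w → g (i ∷ w)) v)
                                 (fold⁺-⊔-upper (λ j → foldᵛ⁺ ℚ._⊔_ (λ w → g (j ∷ w))) i)

    ⊔-below : ∀ {r} p q → fromℚ p ≤ r → fromℚ q ≤ r → fromℚ (p ℚ.⊔ q) ≤ r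
    ⊔-below {r} p q p≤r q≤r =
      [ (λ eq → subst (λ c → fromℚ c ≤ r) (sym eq) p≤r)
      , (λ eq → subst (λ c → fromℚ c ≤ r) (sym eq) q≤r) ]′ (ℚₚ.⊔-sel p q)

    fold⁺-⊔-below : ∀ {r d} (g : Fin (suc d) → ℚ) → (∀ i → fromℚ (g i) ≤ r) → fromℚ (fold⁺ ℚ._⊔_ g) ≤ r
    fold⁺-⊔-below     {d = zero}  g below = below Fin.zero
    fold⁺-⊔-below {r} {d = suc d} g below = ⊔-below {r} (g Fin.zero) (fold⁺ ℚ._⊔_ (g ∘ Fin.suc))
      (below Fin.zero) (fold⁺-⊔-below {r} (g ∘ Fin.suc) (below ∘ Fin.suc))

    foldᵛ⁺-⊔-below : ∀ {r d l} (g : Vec (Fin (suc d)) l → ℚ) → (∀ v → fromℚ (g v) ≤ r) →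
                     fromℚ (foldᵛ⁺ ℚ._⊔_ g) ≤ r
    foldᵛ⁺-⊔-below     {l = zero}  g below = below []
    foldᵛ⁺-⊔-below {r} {l = suc l} g below = fold⁺-⊔-below {r} (λ i → foldᵛ⁺ ℚ._⊔_ (λ v → g (i ∷ v)))
      λ i → foldᵛ⁺-⊔-below {r} (λ v → g (i ∷ v)) λ v → below (i ∷ v)

    error : ℕ → ℚ
    error n = step n ℚ.+ L ℚ.* 2step n

    step≤error : ∀ n → step n ℚ.≤ error n
    step≤error n = ≤+nonneg (step n) (*nonneg 0≤L (+nonneg (0≤step n) (0≤step n)))

    error-small : ∀ ε → 0ℚ ℚ.< ε → ∃ λ N → ∀ n → N ℕ.≤ n → error n ℚ.≤ ε
    error-small ε 0<ε =
      let K           = 1ℚ ℚ.+ (L ℚ.+ L)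
          0<K         = ℚₚ.+-mono-<-≤ (ℚₚ.positive⁻¹ 1ℚ) (+nonneg 0≤L 0≤L)
          δ , 0<δ , Kδ = divide K ε 0<K 0<ε
          N , small   = archimedean δ 0<δ
      in N , λ n N≤n → subst₂ ℚ._≤_ (factor L (step n)) Kδ
           (ℚₚ.*-monoˡ-≤-nonNeg K {{ℚ.nonNegative (ℚₚ.<⇒≤ 0<K)}} (small n N≤n))
      where
      factor : ∀ l h → (1ℚ ℚ.+ (l ℚ.+ l)) ℚ.* h ≡ h ℚ.+ l ℚ.* (h ℚ.+ h)
      factor = solve-∀ ring

    below-maximum : ∀ n y → [0,1]^ m y → f y ≤ fromℚ (maximum n ℚ.+ error n)
    below-maximum n y y∈ =
      let v , near = roundᵛ n y y∈
          g        = f (grid n v)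
          h        = step n
          y-near-g : ∣ f y - g ∣ ≤ fromℚ (L ℚ.* 2step n)
          y-near-g = proj₂ (proj₂ lipschitz) (2step n) (+nonneg (0≤step n) (0≤step n)) near
          y≤       = *≤* (eventually (dist≤⇒≤+ʳ
                       (dist-triangleʳ y-near-g (approx-close g h (0<1/suc n)))))
          rearrange : value n v ℚ.+ (L ℚ.* 2step n ℚ.+ h) ℚ.≤ maximum n ℚ.+ error n
          rearrange = ℚₚ.+-mono-≤ (foldᵛ⁺-⊔-upper (value n) v)
                        (ℚₚ.≤-reflexive (ℚₚ.+-comm (L ℚ.* 2step n) h))
      in ≤-trans y≤ (fromℚ-mono rearrange)

    maximum-below : ∀ {b} n → (∀ y → [0,1]^ m y → f y ≤ b) → fromℚ (maximum n) ≤ b + fromℚ (step n)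
    maximum-below n f≤b = foldᵛ⁺-⊔-below (value n) λ v →
      ≤-trans (dist≤⇒≤+ʳ (dist-commʳ (approx-close (f (grid n v)) (step n) (0<1/suc n))))
              (+-mono-≤ (f≤b (grid n v) (grid∈cube n v)) ≤-refl)

    maximum-compare : ∀ i j → maximum i ℚ.≤ maximum j ℚ.+ (error j ℚ.+ error i)
    maximum-compare i j = ℚₚ.≤-trans
      (fromℚ-cancel (*≤* (eventually (maximum-below i (below-maximum j)))))
      (ℚₚ.≤-trans (ℚₚ.+-monoʳ-≤ (maximum j ℚ.+ error j) (step≤error i))
        (ℚₚ.≤-reflexive (ℚₚ.+-assoc (maximum j) (error j) (error i))))

  sup : ℝ
  sup .seq = maximum
  sup .cauchy ε 0<ε = let N , small = error-small (½ ℚ.* ε) (0<½* 0<ε) in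
        N , λ i j N≤i N≤j →
          let compare : ∀ i j → N ℕ.≤ i → N ℕ.≤ j → maximum i ℚ.≤ maximum j ℚ.+ ε
              compare i j N≤i N≤j = ℚₚ.≤-trans (maximum-compare i j) (ℚₚ.+-monoʳ-≤ (maximum j)
                (subst (_ ℚ.≤_) (½+½ ε) (ℚₚ.+-mono-≤ (small j N≤j) (small i N≤i))))
          in dist≤ (compare i j N≤i N≤j) (compare j i N≤j N≤i)

  private
    sup-upper : ∀ y → [0,1]^ m y → f y ≤ sup
    sup-upper y y∈ = ≤-archimedean λ ε 0<ε →
      let N₁ , small = error-small (½ ℚ.* ε) (0<½* 0<ε)
          N₂ , close = cauchy sup (½ ℚ.* ε) (0<½* 0<ε)
          n          = N₁ ℕ.⊔ N₂
      in ≤-trans (below-maximum n y y∈)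
           (eventually≤ N₂ λ k N₂≤k →
             subst (maximum n ℚ.+ error n ℚ.≤_) (split-ε (maximum k) ε)
               (ℚₚ.+-mono-≤ (dist≤⇒≤+ {maximum n} {maximum k} (close n k (ℕₚ.m≤n⊔m N₁ N₂) N₂≤k))
                            (small n (ℕₚ.m≤m⊔n N₁ N₂))))

    sup-least : ∀ b → (∀ y → [0,1]^ m y → f y ≤ b) → sup ≤ b
    sup-least b f≤b = ≤-archimedean λ ε 0<ε →
      let N₁ , small = archimedean (½ ℚ.* ε) (0<½* 0<ε)
          N₂ , close = cauchy sup (½ ℚ.* ε) (0<½* 0<ε)
          n          = N₁ ℕ.⊔ N₂
          sup≤ : sup ≤ fromℚ (maximum n) + fromℚ (½ ℚ.* ε)
          sup≤ = eventually≤ N₂ λ k N₂≤k →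
                   dist≤⇒≤+ {maximum k} {maximum n} (close k n N₂≤k (ℕₚ.m≤n⊔m N₁ N₂))
          max≤ : fromℚ (maximum n) ≤ b + fromℚ (½ ℚ.* ε)
          max≤ = ≤-trans (maximum-below n f≤b)
                   (+-mono-≤ ≤-refl (fromℚ-mono (small n (ℕₚ.m≤m⊔n N₁ N₂))))
      in ≤-trans (≤-trans sup≤ (+-mono-≤ max≤ ≤-refl))
           (pointwise≤ λ k → ℚₚ.≤-reflexive (split-ε (seq b k) ε))

  sup-isSup : IsSupOn ([0,1]^ m) f sup
  sup-isSup = sup-upper , sup-least

Matrix : Set → ℕ → ℕ → Set
Matrix A n m = Vec (Vec A m) n

infixl 7 _∙_ _*ᵥ_

_∙_ : ∀ {m} → Vec ℝ m → Vec ℝ m → ℝ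
u ∙ v = foldr′ _+_ (fromℕ 0) (zipWith _*_ u v)

_*ᵥ_ : ∀ {n m} → Matrix ℝ n m → Vec ℝ m → Vec ℝ n
A *ᵥ y = map (_∙ y) A

‖_‖∞ : ∀ {n} → Vec ℝ n → ℝ
‖ v ‖∞ = foldr′ _⊔_ (fromℕ 0) (map ∣_∣ v)

binary : ∀ {m} → Vec (Fin 2) m → Vec ℝ m
binary = map (fromℕ ∘ Fin.toℕ)

-- min over x ∈ {0,1}ᵐ of ‖Ax − Ay‖∞.
roundingError : ∀ {n m} → Matrix ℝ n m → Vec ℝ m → ℝ
roundingError A y = foldᵛ⁺ _⊓_ λ x → ‖ zipWith _-_ (A *ᵥ binary x) (A *ᵥ y) ‖∞

module LipschitzLemmas where

  lift₂-dist : ∀ _∙_ (ne : NonExpansive₂ _∙_) {x y x′ y′ c d} →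
               ∣ x - x′ ∣ ≤ fromℚ c → ∣ y - y′ ∣ ≤ fromℚ d →
               ∣ lift₂ _∙_ ne x y - lift₂ _∙_ ne x′ y′ ∣ ≤ fromℚ (c ℚ.+ d)
  lift₂-dist _∙_ ne {x} {y} {x′} {y′} p q =
    *≤* (eventually (≤-trans {∣ lift₂ _∙_ ne x y - lift₂ _∙_ ne x′ y′ ∣}
      (pointwise≤ λ n → ne (seq x n) (seq y n) (seq x′ n) (seq y′ n)) (+-mono-≤ p q)))

  *-distʳ : ∀ a {B N u v c} → 0ℚ ℚ.< B → (∀ n → N ℕ.≤ n → ℚ.∣ seq a n ∣ ℚ.≤ B) →
            ∣ u - v ∣ ≤ fromℚ c → ∣ a * u - a * v ∣ ≤ fromℚ (B ℚ.* c)
  *-distʳ a {B} {N} {u} {v} {c} 0<B bound d =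
    *≤* (eventually (≤-trans
      (eventually≤ {∣ a * u - a * v ∣} {fromℚ B * ∣ u - v ∣} N λ n N≤n →
        subst (ℚ._≤ B ℚ.* ℚ.∣ seq u n ℚ.- seq v n ∣)
          (sym (trans (cong ℚ.∣_∣ (factor (seq a n) (seq u n) (seq v n)))
                      (ℚₚ.∣p*q∣≡∣p∣*∣q∣ (seq a n) (seq u n ℚ.- seq v n))))
          (ℚₚ.*-monoʳ-≤-nonNeg ℚ.∣ seq u n ℚ.- seq v n ∣ {{ℚₚ.∣-∣-nonNeg (seq u n ℚ.- seq v n)}}
            (bound n N≤n)))
      (*-monoˡ-≤ B 0<B d)))
    where
    factor : ∀ p q r → p ℚ.* q ℚ.- p ℚ.* r ≡ p ℚ.* (q ℚ.- r)
    factor = solve-∀ ring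

  const-lipschitz : ∀ {m} c → Lipschitz {m} (λ _ → c)
  const-lipschitz c = 0ℚ , ℚₚ.≤-refl , λ δ _ _ →
    pointwise≤ λ n →
      ℚₚ.≤-reflexive (trans (dist-refl (seq c n)) (sym (ℚₚ.*-zeroˡ δ)))

  lift₁-lipschitz : ∀ g (ne : NonExpansive₁ g) {m} {f : Vec ℝ m → ℝ} → Lipschitz f →
                    Lipschitz (lift₁ g ne ∘ f)
  lift₁-lipschitz g ne {f = f} (L , 0≤L , lip) = L , 0≤L , λ {y} {z} δ 0≤δ near →
    ≤-trans (pointwise≤ λ n → ne (seq (f y) n) (seq (f z) n)) (lip δ 0≤δ near)

  lift₂-lipschitz : ∀ _∙_ (ne : NonExpansive₂ _∙_) {m} {f g : Vec ℝ m → ℝ} →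
                    Lipschitz f → Lipschitz g → Lipschitz (λ y → lift₂ _∙_ ne (f y) (g y))
  lift₂-lipschitz _∙_ ne {f = f} {g} (K , 0≤K , f-lip) (L , 0≤L , g-lip) =
    K ℚ.+ L , +nonneg 0≤K 0≤L , λ {y} {z} δ 0≤δ near →
      subst (λ c → ∣ lift₂ _∙_ ne (f y) (g y) - lift₂ _∙_ ne (f z) (g z) ∣ ≤ fromℚ c)
        (sym (ℚₚ.*-distribʳ-+ δ K L))
        (lift₂-dist _∙_ ne {f y} {g y} {f z} {g z} (f-lip δ 0≤δ near) (g-lip δ 0≤δ near))

  dot-lipschitz : ∀ {m} (u : Vec ℝ m) → Lipschitz (u ∙_)
  dot-lipschitz []      = 0ℚ , ℚₚ.≤-refl , λ δ _ near → dist near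
    where
    dist : ∀ {δ y z} → Near δ y z → ∣ [] ∙ y - [] ∙ z ∣ ≤ fromℚ (0ℚ ℚ.* δ)
    dist {δ} [] = pointwise≤ λ _ → ℚₚ.≤-reflexive (sym (ℚₚ.*-zeroˡ δ))
  dot-lipschitz (a ∷ u) =
    let B , 0<B , N , bound = bounded a
        L , 0≤L , lip       = dot-lipschitz u
    in B ℚ.+ L , +nonneg (ℚₚ.<⇒≤ 0<B) 0≤L , λ δ 0≤δ → dist B L 0<B N bound (lip δ 0≤δ)
    where
    dist : ∀ {δ} B L → 0ℚ ℚ.< B → ∀ N → (∀ n → N ℕ.≤ n → ℚ.∣ seq a n ∣ ℚ.≤ B) →
           (∀ {y z} → Near δ y z → ∣ u ∙ y - u ∙ z ∣ ≤ fromℚ (L ℚ.* δ)) →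
           ∀ {y z} → Near δ y z → ∣ (a ∷ u) ∙ y - (a ∷ u) ∙ z ∣ ≤ fromℚ ((B ℚ.+ L) ℚ.* δ)
    dist {δ} B L 0<B N bound lip {s ∷ y} {t ∷ z} (near ∷ nears) =
      subst (λ c → ∣ (a * s + u ∙ y) - (a * t + u ∙ z) ∣ ≤ fromℚ c) (sym (ℚₚ.*-distribʳ-+ δ B L))
        (lift₂-dist ℚ._+_ +-nonexpansive {a * s} {u ∙ y} {a * t} {u ∙ z}
          (*-distʳ a {B} {N} {s} {t} 0<B bound near) (lip nears))

  norm-lipschitz : ∀ {n m} (A : Matrix ℝ n m) x → Lipschitz λ y → ‖ zipWith _-_ (A *ᵥ x) (A *ᵥ y) ‖∞
  norm-lipschitz []      x = const-lipschitz (fromℕ 0)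
  norm-lipschitz (u ∷ A) x = lift₂-lipschitz ℚ._⊔_ ⊔-nonexpansive
    (lift₁-lipschitz ℚ.∣_∣ ∣∣-nonexpansive
      (lift₂-lipschitz ℚ._-_ -‿nonexpansive (const-lipschitz (u ∙ x)) (dot-lipschitz u)))
    (norm-lipschitz A x)

  fold⁺-⊓-lipschitz : ∀ {d m} {f : Fin (suc d) → Vec ℝ m → ℝ} → (∀ i → Lipschitz (f i)) →
                      Lipschitz (λ y → fold⁺ _⊓_ (λ i → f i y))
  fold⁺-⊓-lipschitz {zero}  lip = lip Fin.zero
  fold⁺-⊓-lipschitz {suc d} lip = lift₂-lipschitz ℚ._⊓_ ⊓-nonexpansive (lip Fin.zero)
    (fold⁺-⊓-lipschitz (lip ∘ Fin.suc))

  foldᵛ⁺-⊓-lipschitz : ∀ {d l m} {f : Vec (Fin (suc d)) l → Vec ℝ m → ℝ} → (∀ v → Lipschitz (f v)) →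
                       Lipschitz (λ y → foldᵛ⁺ _⊓_ (λ v → f v y))
  foldᵛ⁺-⊓-lipschitz {l = zero}  lip = lip []
  foldᵛ⁺-⊓-lipschitz {l = suc l} lip = fold⁺-⊓-lipschitz λ i → foldᵛ⁺-⊓-lipschitz λ v → lip (i ∷ v)

  roundingError-lipschitz : ∀ {n m} (A : Matrix ℝ n m) → Lipschitz (roundingError A)
  roundingError-lipschitz A = foldᵛ⁺-⊓-lipschitz λ x → norm-lipschitz A (binary x)

open LipschitzLemmas

-- Since roundingError A is continuous on the compact cube, its maximum there is its supremum, which
-- unlike a point attaining it exists constructively; lindisc-isSup confirms that this is its value.
lindisc : ∀ {n m} → Matrix ℝ n m → ℝ
lindisc A = Supremum.sup (roundingError A) (roundingError-lipschitz A)

lindisc-isSup : ∀ {n m} (A : Matrix ℝ n m) → IsSupOn ([0,1]^ m) (roundingError A) (lindisc A)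
lindisc-isSup A = Supremum.sup-isSup (roundingError A) (roundingError-lipschitz A)

-- log₂ N = lim ⌊log₂ Nʲ⌋ / j, with the convention log₂ 0 = 0.
log₂ : ℕ → ℝ
log₂ N .seq j = + ⌊log₂ (N ℕ.^ suc j) ⌋ ℚ./ suc j
log₂ N .cauchy ε 0<ε =
  let K , small = archimedean ε 0<ε
      a = λ j → ⌊log₂ (N ℕ.^ suc j) ⌋
      compare : ∀ i j → K ℕ.≤ j → + a i ℚ./ suc i ℚ.≤ + a j ℚ./ suc j ℚ.+ ε
      compare i j K≤j = ℚₚ.≤-trans
        (/ℕ-mono (a i) (suc (a j)) i j (log-approximations N j i))
        (ℚₚ.≤-trans
          (ℚₚ.≤-reflexive (trans (cong (λ k → + k ℚ./ suc j) (ℕₚ.+-comm 1 (a j))) (/ℕ-+ (a j) 1 j)))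
          (ℚₚ.+-monoʳ-≤ (+ a j ℚ./ suc j) (small j K≤j)))
  in K , λ i j K≤i K≤j → dist≤ {seq (log₂ N) i} {seq (log₂ N) j} (compare i j K≤j) (compare j i K≤i)

-- log₂ N is the real number whose rational lower bounds p / q are those with 2ᵖ ≤ Nᑫ.
log₂-characterisation : ∀ N .{{_ : ℕ.NonZero N}} p q →
  (2 ℕ.^ p ℕ.≤ N ℕ.^ suc q) ⇔ (fromℚ (+ p ℚ./ suc q) ≤ log₂ N)
log₂-characterisation N p q = mk⇔ to from
  where
  a : ℕ → ℕ
  a j = ⌊log₂ (N ℕ.^ suc j) ⌋

  to : 2 ℕ.^ p ℕ.≤ N ℕ.^ suc q → fromℚ (+ p ℚ./ suc q) ≤ log₂ N
  to 2^p≤N^q .eventually ε 0<ε =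
    let K , small = archimedean ε 0<ε in K , λ j K≤j → ℚₚ.≤-trans
      (/ℕ-mono p (suc (a j)) q j (ℕₚ.<⇒≤ (2^-cancel-< (begin-strict
        2 ℕ.^ (p ℕ.* suc j)             ≡⟨ ℕₚ.^-*-assoc 2 p (suc j) ⟨
        (2 ℕ.^ p) ℕ.^ suc j             ≤⟨ ℕₚ.^-monoˡ-≤ (suc j) 2^p≤N^q ⟩
        (N ℕ.^ suc q) ℕ.^ suc j         ≡⟨ ^-swap N (suc q) (suc j) ⟩
        (N ℕ.^ suc j) ℕ.^ suc q         <⟨ ℕₚ.^-monoˡ-< (suc q) (n<2^[1+⌊log₂n⌋] (N ℕ.^ suc j)) ⟩
        (2 ℕ.^ suc (a j)) ℕ.^ suc q     ≡⟨ ℕₚ.^-*-assoc 2 (suc (a j)) (suc q) ⟩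
        2 ℕ.^ (suc (a j) ℕ.* suc q)     ∎))))
      (ℚₚ.≤-trans
        (ℚₚ.≤-reflexive (trans (cong (λ k → + k ℚ./ suc j) (ℕₚ.+-comm 1 (a j))) (/ℕ-+ (a j) 1 j)))
        (ℚₚ.+-monoʳ-≤ (+ a j ℚ./ suc j) (small j K≤j)))
    where open ℕₚ.≤-Reasoning

  -- If M = Nᑫ < 2ᵖ then 2 · Mᴹ ≤ 2ᵖᴹ, so every approximation of log₂ N is at most p/q − 1/(qM).
  module _ (N^q<2^p : N ℕ.^ suc q ℕ.< 2 ℕ.^ p) where
    M : ℕ
    M = N ℕ.^ suc q

    instance
      M≢0 : ℕ.NonZero M
      M≢0 = ℕₚ.m^n≢0 N (suc q)

    gap : 2 ℕ.* M ℕ.^ M ℕ.≤ (2 ℕ.^ p) ℕ.^ M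
    gap = ℕₚ.≤-trans (2*M^M≤[1+M]^M M) (ℕₚ.^-monoˡ-≤ M N^q<2^p)

    bound : ∀ j → (a j ℕ.* suc q) ℕ.* M ℕ.+ suc j ℕ.≤ (p ℕ.* suc j) ℕ.* M
    bound j = ℕₚ.≮⇒≥ λ lt → ℕₚ.<⇒≱ (ℕₚ.^-monoʳ-< 2 (ℕ.s≤s (ℕ.s≤s ℕ.z≤n)) lt) (begin
      2 ℕ.^ ((a j ℕ.* suc q) ℕ.* M ℕ.+ suc j)                ≡⟨ ℕₚ.^-distribˡ-+-* 2 ((a j ℕ.* suc q) ℕ.* M) (suc j) ⟩
      2 ℕ.^ ((a j ℕ.* suc q) ℕ.* M) ℕ.* 2 ℕ.^ suc j          ≡⟨ cong (ℕ._* 2 ℕ.^ suc j) (trans (cong (ℕ._^ M) (ℕₚ.^-*-assoc 2 (a j) (suc q))) (ℕₚ.^-*-assoc 2 (a j ℕ.* suc q) M)) ⟨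
      ((2 ℕ.^ a j) ℕ.^ suc q) ℕ.^ M ℕ.* 2 ℕ.^ suc j          ≤⟨ ℕₚ.*-monoˡ-≤ (2 ℕ.^ suc j) (ℕₚ.^-monoˡ-≤ M (ℕₚ.^-monoˡ-≤ (suc q) (2^⌊log₂n⌋≤n (N ℕ.^ suc j) {{ℕₚ.m^n≢0 N (suc j)}}))) ⟩
      ((N ℕ.^ suc j) ℕ.^ suc q) ℕ.^ M ℕ.* 2 ℕ.^ suc j        ≡⟨ cong (ℕ._* 2 ℕ.^ suc j) (trans (cong (ℕ._^ M) (^-swap N (suc j) (suc q))) (^-swap M (suc j) M)) ⟩
      (M ℕ.^ M) ℕ.^ suc j ℕ.* 2 ℕ.^ suc j                    ≡⟨ ^-distribʳ-* (M ℕ.^ M) 2 (suc j) ⟨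
      (M ℕ.^ M ℕ.* 2) ℕ.^ suc j                              ≡⟨ cong (ℕ._^ suc j) (ℕₚ.*-comm (M ℕ.^ M) 2) ⟩
      (2 ℕ.* M ℕ.^ M) ℕ.^ suc j                              ≤⟨ ℕₚ.^-monoˡ-≤ (suc j) gap ⟩
      ((2 ℕ.^ p) ℕ.^ M) ℕ.^ suc j                            ≡⟨ ^-swap (2 ℕ.^ p) M (suc j) ⟩
      ((2 ℕ.^ p) ℕ.^ suc j) ℕ.^ M                            ≡⟨ trans (cong (ℕ._^ M) (ℕₚ.^-*-assoc 2 p (suc j))) (ℕₚ.^-*-assoc 2 (p ℕ.* suc j) M) ⟩
      2 ℕ.^ ((p ℕ.* suc j) ℕ.* M)                            ∎)
      where open ℕₚ.≤-Reasoning

  from : fromℚ (+ p ℚ./ suc q) ≤ log₂ N → 2 ℕ.^ p ℕ.≤ N ℕ.^ suc q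
  from p/q≤ = ℕₚ.≮⇒≥ λ lt →
    let d         = suc q ℕ.* M lt
        w         = + 1 ℚ./ suc d
        0<½w      = 0<½* (0<1/suc d)
        j , above = eventually p/q≤ (½ ℚ.* w) 0<½w
        aⱼ        = + a j ℚ./ suc j
        aⱼ+w≤     : aⱼ ℚ.+ w ℚ.≤ + p ℚ./ suc q
        aⱼ+w≤     = /ℕ-+-≤ (a j) 1 p j d q (ℕₚ.≤-trans
                      (ℕₚ.≤-reflexive (regroup (a j) (suc q) (M lt) (suc j)))
                      (ℕₚ.≤-trans
                        (ℕₚ.+-mono-≤ (ℕₚ.*-monoˡ-≤ (suc q) (bound lt j)) (a*q≤p*j lt j))
                        (ℕₚ.≤-reflexive (regroup′ p (suc q) (M lt) (suc j)))))
    in contradiction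
         (ℚₚ.≤-trans aⱼ+w≤ (above j ℕₚ.≤-refl))
         (λ le → ℚₚ.<-irrefl refl (ℚₚ.<-≤-trans (ℚₚ.+-monoʳ-< aⱼ (subst₂ ℚ._<_ (ℚₚ.+-identityʳ (½ ℚ.* w)) (½+½ w)
           (ℚₚ.+-monoʳ-< (½ ℚ.* w) 0<½w))) le))
    where
    open import Data.Nat.Tactic.RingSolver using () renaming (solve-∀ to ℕ-solve-∀)
    regroup : ∀ a q M j → (a ℕ.* suc (q ℕ.* M) ℕ.+ 1 ℕ.* j) ℕ.* q ≡ ((a ℕ.* q) ℕ.* M ℕ.+ j) ℕ.* q ℕ.+ a ℕ.* q
    regroup = ℕ-solve-∀
    regroup′ : ∀ p q M j → ((p ℕ.* j) ℕ.* M) ℕ.* q ℕ.+ p ℕ.* j ≡ p ℕ.* (j ℕ.* suc (q ℕ.* M))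
    regroup′ = ℕ-solve-∀
    a*q≤p*j : ∀ lt j → a j ℕ.* suc q ℕ.≤ p ℕ.* suc j
    a*q≤p*j lt j = ℕₚ.*-cancelʳ-≤ (a j ℕ.* suc q) (p ℕ.* suc j) (M lt) {{M≢0 lt}}
      (ℕₚ.≤-trans (ℕₚ.m≤m+n _ (suc j)) (bound lt j))

infix 4 _-Monotone_

_-Monotone_ : ℕ → ∀ {n m} → Matrix ℤ n m → Set
k -Monotone A =
  (∀ i j → + 0 ℤ.≤ lookup (lookup A i) j × lookup (lookup A i) j ℤ.≤ + k) ×
  (∀ {i i′} j → i Fin.≤ i′ → lookup (lookup A i) j ℤ.≤ lookup (lookup A i′) j)

{-# OPTIONS --safe #-}
module Submission where

-- Move y inside the cube, preserving r linear forms, until at most r of its coordinates are fractional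
-- (a vertex).  Preserving all of A y leaves at most min(n, m) of them.  From then on, preserve only a
-- few rows: the rows of A increase, so their weights Σ A i j over the f fractional coordinates j form a
-- chain in [0, k f].  Cut this range into blocks of length 2k and preserve one row per block other than
-- the lowest: f at least halves, and every other row moves by at most its weight difference to the
-- preserved row of its block, which is below 2k.  After 1 + ⌊log₂ min(n, m)⌋ halvings y is integral,
-- so the total error is at most 2k · log₂ (2 min(n, m)).

module Rounding where
  import Algebra.Properties.CommutativeMonoid.Sum as Sum
  open import Data.Fin using (Fin; zero; suc; punchIn; punchOut)
  open import Data.Fin.Properties using (any?; punchIn-punchOut) renaming (_≟_ to _≟ᶠ_)
  open import Data.Nat as ℕ using (ℕ; zero; suc)
  import Data.Nat.Properties as ℕₚ
  open import Data.Product using (∃; _×_; _,_)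
  open import Data.Rational
  open import Data.Rational.Properties
  open import Data.Sum using (_⊎_; inj₁; inj₂)
  open import Data.Vec.Functional using (Vector; _∷_)
  open import Function using (_∘_)
  open import Relation.Binary.Definitions using (tri<; tri≈; tri>)
  open import Relation.Binary.PropositionalEquality
  open import Relation.Nullary using (¬_; Dec; yes; no; contradiction)
  open import Relation.Nullary.Decidable using (¬?; _⊎-dec_; decidable-stable)
  open import Tactic.RingSolver using (solve-∀)
  open import Defs using (module RationalLemmas)
  open RationalLemmas

  open Sum +-0-commutativeMonoid using (sum)
  open Sum ℕₚ.+-0-commutativeMonoid using () renaming (sum to sumℕ)

  -- Dot products of rational vectors.

  infix 8 _·_

  _·_ : ∀ {m} → Vector ℚ m → Vector ℚ m → ℚ
  u · y = sum λ j → u j * y j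

  ·-shiftʳ : ∀ {m} (u y z : Vector ℚ m) t → u · (λ j → y j + t * z j) ≡ u · y + t * u · z
  ·-shiftʳ {zero}  u y z t = sym (trans (+-identityˡ _) (*-zeroʳ t))
  ·-shiftʳ {suc m} u y z t =
    trans (cong (u zero * (y zero + t * z zero) +_) (·-shiftʳ (u ∘ suc) (y ∘ suc) (z ∘ suc) t))
          (regroup (u zero) (y zero) (z zero) t ((u ∘ suc) · (y ∘ suc)) ((u ∘ suc) · (z ∘ suc)))
    where
    regroup : ∀ u y z t p q → u * (y + t * z) + (p + t * q) ≡ (u * y + p) + t * (u * z + q)
    regroup = solve-∀ ring

  ·-scaleʳ : ∀ {m} (u z : Vector ℚ m) t → u · (λ j → t * z j) ≡ t * u · z
  ·-scaleʳ {zero}  u z t = sym (*-zeroʳ t)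
  ·-scaleʳ {suc m} u z t =
    trans (cong (u zero * (t * z zero) +_) (·-scaleʳ (u ∘ suc) (z ∘ suc) t))
          (regroup (u zero) (z zero) t ((u ∘ suc) · (z ∘ suc)))
    where
    regroup : ∀ u z t q → u * (t * z) + t * q ≡ t * (u * z + q)
    regroup = solve-∀ ring

  ·-combineˡ : ∀ {m} (u v z : Vector ℚ m) a b →
               (λ j → a * u j - b * v j) · z ≡ a * u · z - b * v · z
  ·-combineˡ {zero}  u v z a b = sym (trans (cong₂ _-_ (*-zeroʳ a) (*-zeroʳ b)) (+-inverseʳ 0ℚ))
  ·-combineˡ {suc m} u v z a b =
    trans (cong ((a * u zero - b * v zero) * z zero +_) (·-combineˡ (u ∘ suc) (v ∘ suc) (z ∘ suc) a b))
          (regroup (u zero) (v zero) (z zero) a b ((u ∘ suc) · (z ∘ suc)) ((v ∘ suc) · (z ∘ suc)))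
    where
    regroup : ∀ u v z a b p q →
              (a * u - b * v) * z + (a * p - b * q) ≡ a * (u * z + p) - b * (v * z + q)
    regroup = solve-∀ ring

  ·-zeroʳ : ∀ {m} (u : Vector ℚ m) → u · (λ _ → 0ℚ) ≡ 0ℚ
  ·-zeroʳ {zero}  u = refl
  ·-zeroʳ {suc m} u = trans (cong₂ _+_ (*-zeroʳ (u zero)) (·-zeroʳ (u ∘ suc))) (+-identityˡ 0ℚ)

  *-≢0 : ∀ {p q} → p ≢ 0ℚ → q ≢ 0ℚ → p * q ≢ 0ℚ
  *-≢0 {p} {q} p≢0 q≢0 pq≡0 = q≢0 (begin
    q                ≡⟨ *-identityˡ q ⟨
    1ℚ * q           ≡⟨ cong (_* q) (*-inverseˡ p) ⟨
    (1/ p * p) * q   ≡⟨ *-assoc (1/ p) p q ⟩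
    1/ p * (p * q)   ≡⟨ cong (1/ p *_) pq≡0 ⟩
    1/ p * 0ℚ        ≡⟨ *-zeroʳ (1/ p) ⟩
    0ℚ               ∎)
    where
    open ≡-Reasoning
    instance
      p-nonZero : NonZero p
      p-nonZero = ≢-nonZero p≢0

  unmoved : ∀ q t {z} → z ≡ 0ℚ → q + t * z ≡ q
  unmoved q t refl = trans (cong (q +_) (*-zeroʳ t)) (+-identityʳ q)

  -- Fractional coordinates and kernel vectors supported on them.

  Integral : ℚ → Set
  Integral q = q ≡ 0ℚ ⊎ q ≡ 1ℚ

  integral? : ∀ q → Dec (Integral q)
  integral? q = (q ≟ 0ℚ) ⊎-dec (q ≟ 1ℚ)

  -- A numeric indicator rather than a predicate, so that the number of fractional coordinates and
  -- the weights of rows are plain sums.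
  fractional : ℚ → ℕ
  fractional q with integral? q
  ... | yes _ = 0
  ... | no  _ = 1

  fractional≤1 : ∀ q → fractional q ℕ.≤ 1
  fractional≤1 q with integral? q
  ... | yes _ = ℕ.z≤n
  ... | no  _ = ℕₚ.≤-refl

  integral⇒fractional≡0 : ∀ {q} → Integral q → fractional q ≡ 0
  integral⇒fractional≡0 {q} p with integral? q
  ... | yes _ = refl
  ... | no ¬p = contradiction p ¬p

  ¬integral⇒fractional≡1 : ∀ {q} → ¬ Integral q → fractional q ≡ 1
  ¬integral⇒fractional≡1 {q} ¬p with integral? q
  ... | yes p = contradiction p ¬p
  ... | no  _ = refl

  #fractional : ∀ {m} → Vector ℚ m → ℕ
  #fractional y = sumℕ (fractional ∘ y)

  -- Gaussian elimination, one column at a time; cross-multiplying avoids dividing by the pivot.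
  kernel : ∀ {m r} (C : Fin r → Vector ℚ m) (y : Vector ℚ m) → r ℕ.< #fractional y →
           ∃ λ z → (∀ j → Integral (y j) → z j ≡ 0ℚ) × (∃ λ j → z j ≢ 0ℚ) × (∀ i → C i · z ≡ 0ℚ)
  kernel {suc m} C y r< with integral? (y zero)
  ... | yes _ =
    let z , supported , (j , z≢0) , orthogonal = kernel (λ i → C i ∘ suc) (y ∘ suc) r<
    in 0ℚ ∷ z
     , (λ where zero _ → refl ; (suc j) → supported j)
     , (suc j , z≢0)
     , λ i → trans (cong₂ _+_ (*-zeroʳ (C i zero)) (orthogonal i)) (+-identityˡ 0ℚ)
  ... | no ¬int with any? (λ i → ¬? (C i zero ≟ 0ℚ))
  ...   | no ∄pivot =
    -- The whole first column vanishes and the first coordinate is fractional, so the first unit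
    -- vector is already admissible.
    1ℚ ∷ (λ _ → 0ℚ)
    , (λ where zero int → contradiction int ¬int ; (suc j) _ → refl)
    , (zero , λ ())
    , λ i → trans (cong₂ _+_ (trans (*-identityʳ (C i zero))
                                    (decidable-stable (C i zero ≟ 0ℚ) λ ≢0 → ∄pivot (i , ≢0)))
                             (·-zeroʳ (C i ∘ suc)))
                  (+-identityˡ 0ℚ)
  kernel {suc m} {suc r} C y (ℕ.s≤s r<) | no ¬int | yes (i₀ , pivot≢0) =
    let z , supported , (j , z≢0) , orthogonal = kernel C′ (y ∘ suc) r<
    in full z
     , (λ where zero int → contradiction int ¬int
                (suc j) int → trans (cong (pivot *_) (supported j int)) (*-zeroʳ pivot))
     , (suc j , *-≢0 pivot≢0 z≢0)
     , λ i → extends z orthogonal i (i₀ ≟ᶠ i)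
    where
    pivot = C i₀ zero
    rest  = C i₀ ∘ suc

    C′ : Fin r → Vector ℚ m
    C′ i j = pivot * C (punchIn i₀ i) (suc j) - C (punchIn i₀ i) zero * rest j

    -- Once the tail is scaled by `pivot`, the leading coordinate that solves row `i₀` is
    -- `- (rest · z)`. The scaling keeps the vector nonzero because the pivot is.
    full : Vector ℚ m → Vector ℚ (suc m)
    full z = (- (rest · z)) ∷ (λ j → pivot * z j)

    extends : ∀ z → (∀ i → C′ i · z ≡ 0ℚ) → ∀ i → Dec (i₀ ≡ i) → C i · full z ≡ 0ℚ
    extends z orthogonal i (yes refl) =
      trans (cong (pivot * (- (rest · z)) +_) (·-scaleʳ rest z pivot)) (cancel pivot (rest · z))
      where
      cancel : ∀ p q → p * (- q) + p * q ≡ 0ℚ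
      cancel = solve-∀ ring
    extends z orthogonal i (no i₀≢i) =
      subst (λ i → C i · full z ≡ 0ℚ) (punchIn-punchOut i₀≢i) (eliminated (punchOut i₀≢i))
      where
      swap : ∀ c q p s → c * (- q) + p * s ≡ p * s - c * q
      swap = solve-∀ ring
      eliminated : ∀ i → C (punchIn i₀ i) · full z ≡ 0ℚ
      eliminated i = let c = C (punchIn i₀ i) in begin
        c zero * (- (rest · z)) + (c ∘ suc) · (λ j → pivot * z j)
          ≡⟨ cong (c zero * (- (rest · z)) +_) (·-scaleʳ (c ∘ suc) z pivot) ⟩
        c zero * (- (rest · z)) + pivot * (c ∘ suc) · z
          ≡⟨ swap (c zero) (rest · z) pivot ((c ∘ suc) · z) ⟩
        pivot * (c ∘ suc) · z - c zero * rest · z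
          ≡⟨ ·-combineˡ (c ∘ suc) rest z pivot (c zero) ⟨
        C′ i · z
          ≡⟨ orthogonal i ⟩
        0ℚ ∎
        where open ≡-Reasoning

  -- Moving along a line until it meets the boundary of the cube.

  Unit : ℚ → Set
  Unit q = 0ℚ ≤ q × q ≤ 1ℚ

  integral⇒unit : ∀ {q} → Integral q → Unit q
  integral⇒unit (inj₁ refl) = ≤-refl , <⇒≤ (positive⁻¹ 1ℚ)
  integral⇒unit (inj₂ refl) = <⇒≤ (positive⁻¹ 1ℚ) , ≤-refl

  ≤∧≢⇒< : ∀ {p q} → p ≤ q → p ≢ q → p < q
  ≤∧≢⇒< {p} {q} p≤q p≢q = ≰⇒> λ q≤p → p≢q (≤-antisym p≤q q≤p)

  -- The direction decides which end is reached: 0 at time `q / (- z)` if `z` is negative, 1 at time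
  -- `(1 - q) / z` if it is positive.
  hitting-time : ∀ {q z} → Unit q → ¬ Integral q → z ≢ 0ℚ → ∃ λ t → 0ℚ ≤ t × Integral (q + t * z)
  hitting-time {q} {z} (0≤q , q≤1) ¬int z≢0 with <-cmp z 0ℚ
  ... | tri< z<0 _ _ =
    let t , 0<t , -zt≡q = divide (- z) q (neg-antimono-< z<0) (≤∧≢⇒< 0≤q (¬int ∘ inj₁ ∘ sym))
    in t , <⇒≤ 0<t , inj₁ (trans (cong (_+ t * z) (sym -zt≡q)) (cancel z t))
    where
    cancel : ∀ z t → (- z) * t + t * z ≡ 0ℚ
    cancel = solve-∀ ring
  ... | tri≈ _ z≡0 _ = contradiction z≡0 z≢0
  ... | tri> _ _ 0<z =
    let t , 0<t , zt≡1-q = divide z (1ℚ - q) 0<z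
          (subst (_< 1ℚ - q) (+-inverseʳ q) (+-monoˡ-< (- q) (≤∧≢⇒< q≤1 (¬int ∘ inj₂))))
    in t , <⇒≤ 0<t , inj₂ (trans (cong (q +_) (trans (*-comm t z) zt≡1-q)) (fill q 1ℚ))
    where
    fill : ∀ q p → q + (p - q) ≡ p
    fill = solve-∀ ring

  -- Convexity: the point at time `s` lies between those at times 0 and `t`. The sign of `z` decides
  -- which of the two bounds it from below.
  unit-between : ∀ {q z s t} → Unit q → Unit (q + t * z) → 0ℚ ≤ s → s ≤ t → Unit (q + s * z)
  unit-between {q} {z} {s} {t} (0≤q , q≤1) (0≤q′ , q′≤1) 0≤s s≤t with ≤-total 0ℚ z
  ... | inj₁ 0≤z = ≤-trans 0≤q (≤+nonneg q (*nonneg 0≤s 0≤z))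
                 , ≤-trans (+-monoʳ-≤ q (*-monoʳ-≤-nonNeg z {{nonNegative 0≤z}} s≤t)) q′≤1
  ... | inj₂ z≤0 = ≤-trans 0≤q′ (+-monoʳ-≤ q (*-monoʳ-≤-nonPos z {{nonPositive z≤0}} s≤t))
                 , ≤-trans (+-monoʳ-≤ q (subst (s * z ≤_) (*-zeroʳ s)
                     (*-monoˡ-≤-nonNeg s {{nonNegative 0≤s}} z≤0)))
                   (≤-trans (≤-reflexive (+-identityʳ q)) q≤1)

  Cube : ∀ {m} → Vector ℚ m → Set
  Cube y = ∀ j → Unit (y j)

  -- The coordinate that becomes integral has to be fractional beforehand; this is what makes the
  -- number of fractional coordinates drop.
  Hits : ∀ {m} → Vector ℚ m → Vector ℚ m → ℚ → Set
  Hits y z t = 0ℚ ≤ t × Cube (λ j → y j + t * z j) ×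
               ∃ λ j → ¬ Integral (y j) × Integral (y j + t * z j)

  -- The time at which a coordinate first reaches 0 or 1 is the least of the hitting times.
  exit : ∀ {m} (y z : Vector ℚ m) → Cube y → (∀ j → Integral (y j) → z j ≡ 0ℚ) →
         (∀ j → z j ≡ 0ℚ) ⊎ ∃ (Hits y z)
  exit {zero}  y z y∈ supported = inj₁ λ ()
  exit {suc m} y z y∈ supported
    with z zero ≟ 0ℚ | exit (y ∘ suc) (z ∘ suc) (y∈ ∘ suc) (supported ∘ suc)
  ... | yes z₀≡0 | inj₁ z≡0 = inj₁ λ where zero → z₀≡0 ; (suc j) → z≡0 j
  ... | yes z₀≡0 | inj₂ (t , 0≤t , in-cube , j , hit) = inj₂
    ( t , 0≤t
    , (λ where zero → subst Unit (sym (unmoved (y zero) t z₀≡0)) (y∈ zero)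
               (suc j) → in-cube j)
    , suc j , hit)
  ... | no z₀≢0 | tail = inj₂ (first tail)
    where
    ¬int₀ : ¬ Integral (y zero)
    ¬int₀ = z₀≢0 ∘ supported zero

    first : (∀ j → z (suc j) ≡ 0ℚ) ⊎ ∃ (Hits (y ∘ suc) (z ∘ suc)) → ∃ (Hits y z)
    first tail with hitting-time (y∈ zero) ¬int₀ z₀≢0 | tail
    ... | t₀ , 0≤t₀ , hit₀ | inj₁ z≡0 = t₀ , 0≤t₀
      , (λ where zero → integral⇒unit hit₀
                 (suc j) → subst Unit (sym (unmoved (y (suc j)) t₀ (z≡0 j))) (y∈ (suc j)))
      , zero , ¬int₀ , hit₀
    ... | t₀ , 0≤t₀ , hit₀ | inj₂ (t , 0≤t , in-cube , j , hit) with ≤-total t₀ t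
    ...   | inj₁ t₀≤t = t₀ , 0≤t₀
      , (λ where zero → integral⇒unit hit₀
                 (suc j) → unit-between (y∈ (suc j)) (in-cube j) 0≤t₀ t₀≤t)
      , zero , ¬int₀ , hit₀
    ...   | inj₂ t≤t₀ = t , 0≤t
      , (λ where zero → unit-between (y∈ zero) (integral⇒unit hit₀) 0≤t t≤t₀
                 (suc j) → in-cube j)
      , suc j , hit

  -- Reaching a vertex while preserving linear forms.

  sumℕ-mono : ∀ {m} {f g : Vector ℕ m} → (∀ j → f j ℕ.≤ g j) → sumℕ f ℕ.≤ sumℕ g
  sumℕ-mono {zero}  f≤g = ℕ.z≤n
  sumℕ-mono {suc m} f≤g = ℕₚ.+-mono-≤ (f≤g zero) (sumℕ-mono (f≤g ∘ suc))

  sumℕ-mono-< : ∀ {m} {f g : Vector ℕ m} → (∀ j → f j ℕ.≤ g j) → ∀ j → f j ℕ.< g j → sumℕ f ℕ.< sumℕ g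
  sumℕ-mono-< f≤g zero    f<g = ℕₚ.+-mono-<-≤ f<g (sumℕ-mono (f≤g ∘ suc))
  sumℕ-mono-< f≤g (suc j) f<g = ℕₚ.+-mono-≤-< (f≤g zero) (sumℕ-mono-< (f≤g ∘ suc) j f<g)

  -- Integral coordinates are frozen exactly, so they stay integral in later moves and contribute
  -- nothing to the change of any row.
  record Refines {m} (y y′ : Vector ℚ m) : Set where
    field
      in-cube : Cube y′
      settled : ∀ j → Integral (y j) → y′ j ≡ y j

  open Refines public

  refines-trans : ∀ {m} {x y z : Vector ℚ m} → Refines x y → Refines y z → Refines x z
  refines-trans p q .in-cube = in-cube q
  refines-trans p q .settled j int =
    trans (settled q j (subst Integral (sym (settled p j int)) int)) (settled p j int)

  -- With more fractional coordinates than forms there is a nonzero direction in the common kernel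
  -- of the forms that fixes the integral coordinates. Following it to the boundary changes no form
  -- and makes a new coordinate integral.
  reduce : ∀ {m r} (C : Fin r → Vector ℚ m) (y : Vector ℚ m) → Cube y → r ℕ.< #fractional y →
           ∃ λ y′ → Refines y y′ × (∀ i → C i · y′ ≡ C i · y) × #fractional y′ ℕ.< #fractional y
  reduce C y y∈ r< with kernel C y r<
  ... | z , supported , (j , z≢0) , orthogonal with exit y z y∈ supported
  ...   | inj₁ z≡0 = contradiction (z≡0 j) z≢0
  ...   | inj₂ (t , _ , y′∈ , k , ¬int , int) = y′ , refines , preserved
    , sumℕ-mono-< fewer k (subst₂ ℕ._<_ (sym (integral⇒fractional≡0 int)) (sym (¬integral⇒fractional≡1 ¬int)) ℕₚ.≤-refl)
    where
    y′ : Vector ℚ _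
    y′ j = y j + t * z j

    refines : Refines y y′
    refines .in-cube = y′∈
    refines .settled j int = unmoved (y j) t (supported j int)

    preserved : ∀ i → C i · y′ ≡ C i · y
    preserved i = begin
      C i · y′               ≡⟨ ·-shiftʳ (C i) y z t ⟩
      C i · y + t * C i · z  ≡⟨ unmoved (C i · y) t (orthogonal i) ⟩
      C i · y                ∎
      where open ≡-Reasoning

    fewer : ∀ j → fractional (y′ j) ℕ.≤ fractional (y j)
    fewer j with integral? (y j)
    ... | yes int = ℕₚ.≤-reflexive (integral⇒fractional≡0 (subst Integral (sym (settled refines j int)) int))
    ... | no  _   = fractional≤1 (y′ j)

  -- `reduce` is iterated while more than `r` coordinates are fractional. Their number drops
  -- strictly each time, so the bound `f` in `go` can serve as the recursion argument.
  vertex : ∀ {m r} (C : Fin r → Vector ℚ m) (y : Vector ℚ m) → Cube y →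
           ∃ λ y′ → Refines y y′ × (∀ i → C i · y′ ≡ C i · y) × #fractional y′ ℕ.≤ r
  vertex {r = r} C y y∈ = go (#fractional y) y y∈ ℕₚ.≤-refl
    where
    go : ∀ f y → Cube y → #fractional y ℕ.≤ f →
         ∃ λ y′ → Refines y y′ × (∀ i → C i · y′ ≡ C i · y) × #fractional y′ ℕ.≤ r
    go f y y∈ ≤f with #fractional y ℕ.≤? r
    ... | yes ≤r = y , record { in-cube = y∈ ; settled = λ _ _ → refl } , (λ _ → refl) , ≤r
    go zero    y y∈ ≤f | no ≰r = contradiction (ℕₚ.≤-trans ≤f ℕ.z≤n) ≰r
    go (suc f) y y∈ ≤f | no ≰r =
      let y′ , ref  , same  , lt = reduce C y y∈ (ℕₚ.≰⇒> ≰r)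
          x  , ref′ , same′ , ≤r = go f y′ (in-cube ref) (ℕₚ.≤-pred (ℕₚ.≤-trans lt ≤f))
      in x , refines-trans ref ref′ , (λ i → trans (same′ i) (same i)) , ≤r

module Blocks where
  import Algebra.Properties.CommutativeMonoid.Sum as Sum
  open import Data.Fin as Fin using (Fin; zero; suc)
  open import Data.Fin.Properties using (any?; toℕ-fromℕ<)
  import Data.Integer as ℤ
  open import Data.Nat as ℕ using (ℕ; zero; suc)
  import Data.Nat.DivMod as ℕ
  import Data.Nat.Properties as ℕₚ
  open import Data.Product using (∃; _×_; _,_)
  open import Data.Rational
  open import Data.Rational.Properties
  open import Data.Sum using (_⊎_; inj₁; inj₂)
  open import Data.Vec.Functional using (Vector)
  open import Function using (_∘_)
  open import Relation.Binary.PropositionalEquality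
  open import Relation.Nullary using (yes; no; contradiction)
  open import Tactic.RingSolver using (solve-∀)
  open import Defs using (module RationalLemmas)
  open RationalLemmas
  open Rounding

  open Sum ℕₚ.+-0-commutativeMonoid using () renaming
    (sum to sumℕ; sum-cong-≗ to sumℕ-cong; ∑-distrib-+ to sumℕ-+)

  -- Weights of rows and the change of a row under a move.

  ι : ℕ → ℚ
  ι a = ℤ.+ a / 1

  ι-mono : ∀ {a b} → a ℕ.≤ b → ι a ≤ ι b
  ι-mono {a} {b} a≤b = /ℕ-mono a b 0 0 (ℕₚ.*-monoˡ-≤ 1 a≤b)

  ι-dist : ∀ a b → ∣ ι a - ι b ∣ ≤ ι ℕ.∣ a - b ∣
  ι-dist a b = dist≤ (bound a b) (subst (λ d → ι b ≤ ι a + ι d) (ℕₚ.∣-∣-comm b a) (bound b a))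
    where
    bound : ∀ a b → ι a ≤ ι b + ι ℕ.∣ a - b ∣
    bound a b = ≤-trans (ι-mono (ℕₚ.m≤n+∣m-n∣ a b)) (≤-reflexive (/ℕ-+ b ℕ.∣ a - b ∣ 0))

  unit-dist : ∀ {p q} → Unit p → Unit q → ∣ p - q ∣ ≤ 1ℚ
  unit-dist {p} {q} (0≤p , p≤1) (0≤q , q≤1) = dist≤ (bound p≤1 0≤q) (bound q≤1 0≤p)
    where
    bound : ∀ {p q} → p ≤ 1ℚ → 0ℚ ≤ q → p ≤ q + 1ℚ
    bound {p} {q} p≤1 0≤q = ≤-trans p≤1 (subst (_≤ q + 1ℚ) (+-identityˡ 1ℚ) (+-monoˡ-≤ 1ℚ 0≤q))

  weight : ∀ {m} → Vector ℚ m → Vector ℕ m → ℕ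
  weight y u = sumℕ λ j → fractional (y j) ℕ.* u j

  -- Only coordinates that are fractional in `y` move, each by at most 1. So coordinate `j`
  -- contributes at most the distance of `u j` and `v j` to the difference between the changes of
  -- the two rows.
  deviation : ∀ {m} (u v : Vector ℕ m) {y y′ : Vector ℚ m} → Cube y → Refines y y′ →
              ∣ ((ι ∘ v) · y′ - (ι ∘ v) · y) - ((ι ∘ u) · y′ - (ι ∘ u) · y) ∣ ≤
              ι (weight y λ j → ℕ.∣ v j - u j ∣)
  deviation {zero}  u v y∈ ref = ≤-refl
  deviation {suc m} u v {y} {y′} y∈ ref = begin
    ∣ ((v₀ * y′₀ + v·y′) - (v₀ * y₀ + v·y)) - ((u₀ * y′₀ + u·y′) - (u₀ * y₀ + u·y)) ∣
      ≡⟨ cong ∣_∣ (regroup u₀ v₀ y₀ y′₀ v·y′ v·y u·y′ u·y) ⟩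
    ∣ (v₀ - u₀) * (y′₀ - y₀) + ((v·y′ - v·y) - (u·y′ - u·y)) ∣
      ≤⟨ ∣p+q∣≤∣p∣+∣q∣ ((v₀ - u₀) * (y′₀ - y₀)) ((v·y′ - v·y) - (u·y′ - u·y)) ⟩
    ∣ (v₀ - u₀) * (y′₀ - y₀) ∣ + ∣ (v·y′ - v·y) - (u·y′ - u·y) ∣
      ≤⟨ +-mono-≤ head (deviation (u ∘ suc) (v ∘ suc) (y∈ ∘ suc) ref-tail) ⟩
    ι (fractional (y zero) ℕ.* d) + ι (weight (y ∘ suc) λ j → ℕ.∣ v (suc j) - u (suc j) ∣)
      ≡⟨ /ℕ-+ (fractional (y zero) ℕ.* d) (weight (y ∘ suc) λ j → ℕ.∣ v (suc j) - u (suc j) ∣) 0 ⟨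
    ι (weight y λ j → ℕ.∣ v j - u j ∣) ∎
    where
    open ≤-Reasoning
    u₀ = ι (u zero)
    v₀ = ι (v zero)
    y₀ = y zero
    y′₀ = y′ zero
    v·y′ = (ι ∘ v ∘ suc) · (y′ ∘ suc)
    v·y  = (ι ∘ v ∘ suc) · (y ∘ suc)
    u·y′ = (ι ∘ u ∘ suc) · (y′ ∘ suc)
    u·y  = (ι ∘ u ∘ suc) · (y ∘ suc)
    d = ℕ.∣ v zero - u zero ∣

    regroup : ∀ u v y y′ p q r s →
              ((v * y′ + p) - (v * y + q)) - ((u * y′ + r) - (u * y + s)) ≡
              (v - u) * (y′ - y) + ((p - q) - (r - s))
    regroup = solve-∀ ring

    ref-tail : Refines (y ∘ suc) (y′ ∘ suc)
    ref-tail .in-cube = in-cube ref ∘ suc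
    ref-tail .settled = settled ref ∘ suc

    head : ∣ (v₀ - u₀) * (y′₀ - y₀) ∣ ≤ ι (fractional (y zero) ℕ.* d)
    head with integral? (y zero)
    ... | yes int = ≤-reflexive (trans
      (cong (λ q → ∣ (v₀ - u₀) * (q - y₀) ∣) (settled ref zero int))
      (cong ∣_∣ (vanish (v₀ - u₀) y₀)))
      where
      vanish : ∀ p q → p * (q - q) ≡ 0ℚ
      vanish = solve-∀ ring
    ... | no _ = begin
      ∣ (v₀ - u₀) * (y′₀ - y₀) ∣    ≡⟨ ∣p*q∣≡∣p∣*∣q∣ (v₀ - u₀) (y′₀ - y₀) ⟩
      ∣ v₀ - u₀ ∣ * ∣ y′₀ - y₀ ∣    ≤⟨ *-monoˡ-≤-nonNeg ∣ v₀ - u₀ ∣ {{∣-∣-nonNeg (v₀ - u₀)}} (unit-dist (in-cube ref zero) (y∈ zero)) ⟩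
      ∣ v₀ - u₀ ∣ * 1ℚ              ≡⟨ *-identityʳ ∣ v₀ - u₀ ∣ ⟩
      ∣ v₀ - u₀ ∣                   ≤⟨ ι-dist (v zero) (u zero) ⟩
      ι d                           ≡⟨ cong ι (ℕₚ.*-identityˡ d) ⟨
      ι (1 ℕ.* d)                   ∎

  Comparable : ∀ {m} → Vector ℕ m → Vector ℕ m → Set
  Comparable u v = (∀ j → u j ℕ.≤ v j) ⊎ (∀ j → v j ℕ.≤ u j)

  -- For comparable rows the weight of the entrywise distance is the difference of the two weights,
  -- and numbers with equal quotients by `c` are within `c` of each other.
  weight-close : ∀ {m} (y : Vector ℚ m) (u v : Vector ℕ m) c .{{_ : ℕ.NonZero c}} → Comparable u v →
                 weight y u ℕ./ c ≡ weight y v ℕ./ c →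
                 weight y (λ j → ℕ.∣ v j - u j ∣) ℕ.≤ c
  weight-close y u v c (inj₁ u≤v) same-quotient = ℕₚ.+-cancelʳ-≤ (weight y u) _ c (begin
    weight y (λ j → ℕ.∣ v j - u j ∣) ℕ.+ weight y u
      ≡⟨ sumℕ-+ (λ j → fractional (y j) ℕ.* ℕ.∣ v j - u j ∣) (λ j → fractional (y j) ℕ.* u j) ⟨
    (sumℕ λ j → fractional (y j) ℕ.* ℕ.∣ v j - u j ∣ ℕ.+ fractional (y j) ℕ.* u j)
      ≡⟨ sumℕ-cong (λ j → trans (sym (ℕₚ.*-distribˡ-+ (fractional (y j)) ℕ.∣ v j - u j ∣ (u j)))
           (cong (fractional (y j) ℕ.*_)
             (trans (cong (ℕ._+ u j) (ℕₚ.m≤n⇒∣n-m∣≡n∸m (u≤v j))) (ℕₚ.m∸n+n≡m (u≤v j))))) ⟩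
    weight y v                                              ≡⟨ ℕ.m≡m%n+[m/n]*n (weight y v) c ⟩
    weight y v ℕ.% c ℕ.+ (weight y v ℕ./ c) ℕ.* c           ≤⟨ ℕₚ.+-mono-≤ (ℕ.m%n≤n (weight y v) c) (ℕₚ.≤-reflexive (cong (ℕ._* c) (sym same-quotient))) ⟩
    c ℕ.+ (weight y u ℕ./ c) ℕ.* c                          ≤⟨ ℕₚ.+-monoʳ-≤ c (ℕ.m/n*n≤m (weight y u) c) ⟩
    c ℕ.+ weight y u                                        ∎)
    where open ℕₚ.≤-Reasoning
  weight-close y u v c (inj₂ v≤u) same-quotient =
    subst (ℕ._≤ c) (sumℕ-cong λ j → cong (fractional (y j) ℕ.*_) (ℕₚ.∣-∣-comm (u j) (v j)))
      (weight-close y v u c (inj₁ v≤u) (sym same-quotient))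

  weight≤ : ∀ {m} (y : Vector ℚ m) (u : Vector ℕ m) k → (∀ j → u j ℕ.≤ k) →
            weight y u ℕ.≤ #fractional y ℕ.* k
  weight≤ {zero}  y u k u≤k = ℕ.z≤n
  weight≤ {suc m} y u k u≤k = ℕₚ.≤-trans
    (ℕₚ.+-mono-≤ (ℕₚ.*-monoʳ-≤ (fractional (y zero)) (u≤k zero)) (weight≤ (y ∘ suc) (u ∘ suc) k (u≤k ∘ suc)))
    (ℕₚ.≤-reflexive (sym (ℕₚ.*-distribʳ-+ k (fractional (y zero)) (#fractional (y ∘ suc)))))

  weight-zero : ∀ {m} (y : Vector ℚ m) → weight y (λ _ → 0) ≡ 0
  weight-zero {zero}  y = refl
  weight-zero {suc m} y = cong₂ ℕ._+_ (ℕₚ.*-zeroʳ (fractional (y zero))) (weight-zero (y ∘ suc))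

  ·-zeroˡ : ∀ {m} (y : Vector ℚ m) → (λ _ → 0ℚ) · y ≡ 0ℚ
  ·-zeroˡ {zero}  y = refl
  ·-zeroˡ {suc m} y = trans (cong₂ _+_ (*-zeroˡ (y zero)) (·-zeroˡ (y ∘ suc))) (+-identityˡ 0ℚ)

  #fractional≤ : ∀ {m} (y : Vector ℚ m) → #fractional y ℕ.≤ m
  #fractional≤ {zero}  y = ℕ.z≤n
  #fractional≤ {suc m} y = ℕₚ.+-mono-≤ (fractional≤1 (y zero)) (#fractional≤ (y ∘ suc))

  #fractional<1⇒integral : ∀ {m} (y : Vector ℚ m) → #fractional y ℕ.< 1 → ∀ j → Integral (y j)
  #fractional<1⇒integral y <1 zero with integral? (y zero)
  ... | yes int = int
  #fractional<1⇒integral y (ℕ.s≤s ()) zero | no _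
  #fractional<1⇒integral y <1 (suc j) =
    #fractional<1⇒integral (y ∘ suc) (ℕₚ.≤-<-trans (ℕₚ.m≤n+m _ (fractional (y zero))) <1) j

  -- Halving the number of fractional coordinates.

  module _ {n m} (k : ℕ) .{{_ : ℕ.NonZero k}} (B : Fin n → Vector ℕ m)
           (B≤k : ∀ i j → B i j ℕ.≤ k) (B-chain : ∀ i i′ → Comparable (B i) (B i′)) where

    private
      2k = 2 ℕ.* k
      instance
        2k≢0 : ℕ.NonZero 2k
        2k≢0 = ℕₚ.m*n≢0 2 k

    -- Rows whose weights on the fractional coordinates agree up to 2k form a block.  Keeping one row
    -- of each block fixed moves the others by at most 2k; the lowest block needs no constraint, as
    -- the zero row belongs to it.
    halve : ∀ s (y : Vector ℚ m) → Cube y → #fractional y ℕ.< 2 ℕ.* suc s →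
            ∃ λ y′ → Refines y y′ × (∀ i → ∣ (ι ∘ B i) · y′ - (ι ∘ B i) · y ∣ ≤ ι 2k) ×
                     #fractional y′ ℕ.< suc s
    halve s y y∈ #y< =
      let y′ , ref , same , #y′≤s = vertex (λ b → ι ∘ representative b) y y∈
      in y′ , ref , (λ i → error ref same i) , ℕ.s≤s #y′≤s
      where
      block : Fin n → ℕ
      block i = weight y (B i) ℕ./ 2k

      -- With fewer than `2 * suc s` fractional coordinates all weights lie below `suc s * 2k`. The
      -- blocks are thus numbered 0 to `s`, and leaving out block 0 leaves `s` constraints for
      -- `vertex`.
      block< : ∀ i → block i ℕ.< suc s
      block< i = ℕ.m<n*o⇒m/o<n {n = suc s} {2k} (begin-strict
        weight y (B i)         ≤⟨ weight≤ y (B i) k (B≤k i) ⟩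
        #fractional y ℕ.* k    <⟨ ℕₚ.*-monoˡ-< k #y< ⟩
        2 ℕ.* suc s ℕ.* k      ≡⟨ cong (ℕ._* k) (ℕₚ.*-comm 2 (suc s)) ⟩
        suc s ℕ.* 2 ℕ.* k      ≡⟨ ℕₚ.*-assoc (suc s) 2 k ⟩
        suc s ℕ.* 2k           ∎)
        where open ℕₚ.≤-Reasoning

      -- Index `b` stands for block `suc b`, as block 0 is unconstrained. An empty block receives
      -- the zero row, whose constraint is vacuous.
      representative : Fin s → Vector ℕ m
      representative b with any? (λ i → block i ℕ.≟ suc (Fin.toℕ b))
      ... | yes (i , _) = B i
      ... | no  _       = λ _ → 0

      represents : ∀ b i → block i ≡ suc (Fin.toℕ b) →
                   ∃ λ i′ → block i′ ≡ block i × representative b ≡ B i′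
      represents b i eq with any? (λ i → block i ℕ.≟ suc (Fin.toℕ b))
      ... | yes (i′ , eq′) = i′ , trans eq′ (sym eq) , refl
      ... | no  ∄i         = contradiction (i , eq) ∄i

      error : ∀ {y′} → Refines y y′ →
              (∀ b → (ι ∘ representative b) · y′ ≡ (ι ∘ representative b) · y) →
              ∀ i → ∣ (ι ∘ B i) · y′ - (ι ∘ B i) · y ∣ ≤ ι 2k
      error {y′} ref same i = bound (block i) refl
        where
        -- The preserved row `u` has change zero, so subtracting it turns the error of row `i` into
        -- the quantity bounded by `deviation`.
        via : ∀ u → Comparable u (B i) → weight y u ℕ./ 2k ≡ block i →
              (ι ∘ u) · y′ ≡ (ι ∘ u) · y → ∣ (ι ∘ B i) · y′ - (ι ∘ B i) · y ∣ ≤ ι 2k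
        via u comparable same-block u·y′≡u·y = begin
          ∣ (ι ∘ B i) · y′ - (ι ∘ B i) · y ∣
            ≡⟨ cong ∣_∣ (trans (cong (p +_) (cong (-_) (trans (cong (_- (ι ∘ u) · y) u·y′≡u·y)
                                                          (+-inverseʳ ((ι ∘ u) · y)))))
                               (+-identityʳ p)) ⟨
          ∣ p - ((ι ∘ u) · y′ - (ι ∘ u) · y) ∣
            ≤⟨ deviation u (B i) y∈ ref ⟩
          ι (weight y λ j → ℕ.∣ B i j - u j ∣)
            ≤⟨ ι-mono (weight-close y u (B i) 2k comparable same-block) ⟩
          ι 2k ∎
          where
          open ≤-Reasoning
          p = (ι ∘ B i) · y′ - (ι ∘ B i) · y

        bound : ∀ q → block i ≡ q → ∣ (ι ∘ B i) · y′ - (ι ∘ B i) · y ∣ ≤ ι 2k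
        bound zero eq = via (λ _ → 0) (inj₁ λ _ → ℕ.z≤n)
          (trans (cong (ℕ._/ 2k) (weight-zero y)) (trans (ℕ.0/n≡0 2k) (sym eq)))
          (trans (·-zeroˡ y′) (sym (·-zeroˡ y)))
        bound (suc q) eq =
          let q<s           = ℕₚ.≤-pred (subst (ℕ._< suc s) eq (block< i))
              b             = Fin.fromℕ< q<s
              i′ , eq′ , is = represents b i (trans eq (cong suc (sym (toℕ-fromℕ< q<s))))
          in via (B i′) (B-chain i′ i) eq′ (subst (λ u → (ι ∘ u) · y′ ≡ (ι ∘ u) · y) is (same b))

    -- Each halving costs at most `2k` and lowers the exponent by one. At exponent 0 the strict
    -- bound leaves no fractional coordinate.
    halve-repeatedly : ∀ l (y : Vector ℚ m) → Cube y → #fractional y ℕ.< 2 ℕ.^ l →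
      ∃ λ x → (∀ j → Integral (x j)) × (∀ i → ∣ (ι ∘ B i) · x - (ι ∘ B i) · y ∣ ≤ ι (l ℕ.* 2k))
    halve-repeatedly zero y y∈ #y< =
      y , #fractional<1⇒integral y #y< , λ i → ≤-reflexive (dist-refl ((ι ∘ B i) · y))
    -- `halve` takes its bound in the form `2 * suc s`, so the positive number `2 ^ l` is exposed as
    -- a successor.
    halve-repeatedly (suc l) y y∈ #y< with 2 ℕ.^ l in eq
    ... | zero  = contradiction (subst (0 ℕ.<_) eq (ℕₚ.m^n>0 2 l)) λ ()
    ... | suc s =
      let y′ , ref , near , #y′<  = halve s y y∈ #y<
          x  , int , near′        = halve-repeatedly l y′ (in-cube ref) (subst (#fractional y′ ℕ.<_) (sym eq) #y′<)
      in x , int , λ i → begin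
           ∣ (ι ∘ B i) · x - (ι ∘ B i) · y ∣
             ≤⟨ dist-triangle ((ι ∘ B i) · x) ((ι ∘ B i) · y′) ((ι ∘ B i) · y) ⟩
           ∣ (ι ∘ B i) · x - (ι ∘ B i) · y′ ∣ + ∣ (ι ∘ B i) · y′ - (ι ∘ B i) · y ∣
             ≤⟨ +-mono-≤ (near′ i) (near i) ⟩
           ι (l ℕ.* 2k) + ι 2k
             ≡⟨ /ℕ-+ (l ℕ.* 2k) 2k 0 ⟨
           ι (l ℕ.* 2k ℕ.+ 2k)
             ≡⟨ cong ι (ℕₚ.+-comm (l ℕ.* 2k) 2k) ⟩
           ι (suc l ℕ.* 2k) ∎
      where open ≤-Reasoning

    rounding : ∀ l → n ℕ.⊓ m ℕ.< 2 ℕ.^ l → (y : Vector ℚ m) → Cube y →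
      ∃ λ x → (∀ j → Integral (x j)) × (∀ i → ∣ (ι ∘ B i) · x - (ι ∘ B i) · y ∣ ≤ ι (l ℕ.* 2k))
    rounding l n⊓m< y y∈ =
      -- All rows are preserved here, so this first move is free of error. The number of forms
      -- bounds the fractional coordinates by `n`, the dimension by `m`.
      let y′ , ref , same , #y′≤n = vertex (λ i → ι ∘ B i) y y∈
          x  , int , near         = halve-repeatedly l y′ (in-cube ref)
                                      (ℕₚ.≤-<-trans (ℕₚ.⊓-glb #y′≤n (#fractional≤ y′)) n⊓m<)
      in x , int , λ i → subst (λ p → ∣ (ι ∘ B i) · x - p ∣ ≤ ι (l ℕ.* 2k)) (same i) (near i)

open import Defs
open import Data.Integer using (ℤ)
open import Data.Nat as ℕ using (ℕ)
open import Data.Vec using (map)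

module RealBounds where
  open import Data.Fin as Fin using (Fin; zero; suc)
  import Data.Fin.Properties as Finₚ
  open import Data.Integer as ℤ using (+_)
  import Data.Integer.Properties as ℤₚ
  open import Data.Nat using (zero; suc)
  open import Data.Nat.Logarithm using (⌊log₂_⌋)
  import Data.Nat.Properties as ℕₚ
  open import Data.Product using (_,_; proj₁)
  open import Data.Rational as ℚ using (ℚ; 0ℚ; 1ℚ)
  import Data.Rational.Properties as ℚₚ
  open import Data.Sum using (inj₁; inj₂)
  open import Data.Vec using (Vec; []; _∷_; lookup; tabulate; zipWith)
  open import Data.Vec.Functional using (Vector)
  open import Data.Vec.Properties using (lookup-map; lookup-zipWith; lookup∘tabulate)
  open import Function using (_∘_; Equivalence)
  open import Relation.Binary.PropositionalEquality
  open RationalLemmas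
  open LogarithmLemmas
  open RealLemmas
  open LipschitzLemmas
  open Rounding
  open Blocks

  -- Transfer of the rational rounding to the terms of real sequences.

  -- Real operations act term by term, so fixing the index `t` turns a statement about real vectors
  -- into one about rational vectors.
  at : ∀ {m} → ℕ → Vec ℝ m → Vector ℚ m
  at t v j = seq (lookup v j) t

  seq-∙ : ∀ {m} (u v : Vec ℝ m) t → seq (u ∙ v) t ≡ at t u · at t v
  seq-∙ []      []      t = refl
  seq-∙ (a ∷ u) (b ∷ v) t = cong (seq a t ℚ.* seq b t ℚ.+_) (seq-∙ u v t)

  seq-norm≤ : ∀ {n} (w : Vec ℝ n) t {c} → 0ℚ ℚ.≤ c → (∀ i → ℚ.∣ at t w i ∣ ℚ.≤ c) →
              seq ‖ w ‖∞ t ℚ.≤ c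
  seq-norm≤ []      t 0≤c ≤c = 0≤c
  seq-norm≤ (a ∷ w) t 0≤c ≤c = ℚₚ.⊔-lub (≤c zero) (seq-norm≤ w t 0≤c (≤c ∘ suc))

  seq-fold⁺-⊓≤ : ∀ {d} (f : Fin (suc d) → ℝ) t i → seq (fold⁺ _⊓_ f) t ℚ.≤ seq (f i) t
  seq-fold⁺-⊓≤ {zero}  f t zero    = ℚₚ.≤-refl
  seq-fold⁺-⊓≤ {suc d} f t zero    = ℚₚ.p⊓q≤p (seq (f zero) t) (seq (fold⁺ _⊓_ (f ∘ suc)) t)
  seq-fold⁺-⊓≤ {suc d} f t (suc i) =
    ℚₚ.≤-trans (ℚₚ.p⊓q≤q (seq (f zero) t) (seq (fold⁺ _⊓_ (f ∘ suc)) t)) (seq-fold⁺-⊓≤ (f ∘ suc) t i)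

  seq-foldᵛ⁺-⊓≤ : ∀ {d m} (f : Vec (Fin (suc d)) m → ℝ) t v → seq (foldᵛ⁺ _⊓_ f) t ℚ.≤ seq (f v) t
  seq-foldᵛ⁺-⊓≤ f t []      = ℚₚ.≤-refl
  seq-foldᵛ⁺-⊓≤ f t (i ∷ v) = ℚₚ.≤-trans
    (seq-fold⁺-⊓≤ (λ j → foldᵛ⁺ _⊓_ λ w → f (j ∷ w)) t i) (seq-foldᵛ⁺-⊓≤ (λ w → f (i ∷ w)) t v)

  fold⁺-⊔≤ : ∀ {d} (f : Fin (suc d) → ℚ) {c} → (∀ i → f i ℚ.≤ c) → fold⁺ ℚ._⊔_ f ℚ.≤ c
  fold⁺-⊔≤ {zero}  f ≤c = ≤c zero
  fold⁺-⊔≤ {suc d} f ≤c = ℚₚ.⊔-lub (≤c zero) (fold⁺-⊔≤ (f ∘ suc) (≤c ∘ suc))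

  foldᵛ⁺-⊔≤ : ∀ {d m} (f : Vec (Fin (suc d)) m → ℚ) {c} → (∀ v → f v ℚ.≤ c) → foldᵛ⁺ ℚ._⊔_ f ℚ.≤ c
  foldᵛ⁺-⊔≤ {m = zero}  f ≤c = ≤c []
  foldᵛ⁺-⊔≤ {m = suc m} f ≤c =
    fold⁺-⊔≤ (λ i → foldᵛ⁺ ℚ._⊔_ λ w → f (i ∷ w)) λ i → foldᵛ⁺-⊔≤ (λ w → f (i ∷ w)) λ w → ≤c (i ∷ w)

  bit : ∀ {q} → Integral q → Fin 2
  bit (inj₁ _) = zero
  bit (inj₂ _) = suc zero

  seq-bit : ∀ {q} (int : Integral q) → + Fin.toℕ (bit int) ℚ./ 1 ≡ q
  seq-bit (inj₁ refl) = refl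
  seq-bit (inj₂ refl) = refl

  ·-cong : ∀ {m} {u v y z : Vector ℚ m} → (∀ j → u j ≡ v j) → (∀ j → y j ≡ z j) → u · y ≡ v · z
  ·-cong {zero}  u≗v y≗z = refl
  ·-cong {suc m} u≗v y≗z = cong₂ ℚ._+_ (cong₂ ℚ._*_ (u≗v zero) (y≗z zero)) (·-cong (u≗v ∘ suc) (y≗z ∘ suc))

  -- The minimum is at most its value at the binary vector that encodes `x`. As minima are also
  -- taken term by term, `x` may depend on `t`.
  seq-roundingError≤ : ∀ {n m} (A : Matrix ℝ n m) (y : Vec ℝ m) t {c} (x : Vector ℚ m) →
    (∀ j → Integral (x j)) → 0ℚ ℚ.≤ c →
    (∀ i → ℚ.∣ at t (lookup A i) · x ℚ.- at t (lookup A i) · at t y ∣ ℚ.≤ c) →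
    seq (roundingError A y) t ℚ.≤ c
  seq-roundingError≤ {n} {m} A y t {c} x int 0≤c near = ℚₚ.≤-trans
    (seq-foldᵛ⁺-⊓≤ (λ b → ‖ zipWith _-_ (A *ᵥ binary b) (A *ᵥ y) ‖∞) t bits)
    (seq-norm≤ (zipWith _-_ (A *ᵥ binary bits) (A *ᵥ y)) t 0≤c λ i →
      subst (λ q → ℚ.∣ q ∣ ℚ.≤ c) (sym (entry i)) (near i))
    where
    bits : Vec (Fin 2) m
    bits = tabulate λ j → bit (int j)

    at-bits : ∀ j → at t (binary bits) j ≡ x j
    at-bits j = trans (cong (λ r → seq r t) (lookup-map j (fromℕ ∘ Fin.toℕ) bits))
      (trans (cong (λ b → + Fin.toℕ b ℚ./ 1) (lookup∘tabulate (λ j → bit (int j)) j)) (seq-bit (int j)))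

    product : ∀ (z : Vec ℝ m) i → at t (A *ᵥ z) i ≡ at t (lookup A i) · at t z
    product z i = trans (cong (λ r → seq r t) (lookup-map i (_∙ z) A)) (seq-∙ (lookup A i) z t)

    entry : ∀ i → at t (zipWith _-_ (A *ᵥ binary bits) (A *ᵥ y)) i ≡
                  at t (lookup A i) · x ℚ.- at t (lookup A i) · at t y
    entry i = trans (cong (λ r → seq r t) (lookup-zipWith _-_ i (A *ᵥ binary bits) (A *ᵥ y)))
      (cong₂ ℚ._-_ (trans (product (binary bits) i) (·-cong {u = at t (lookup A i)} (λ _ → refl) at-bits)) (product y i))

  -- The terms of lindisc A are maxima over grid points of the cube, all of them rational.
  lindisc≤ : ∀ {n m} (A : Matrix ℝ n m) {c} →
             (∀ y t → Cube (at t y) → seq (roundingError A y) t ℚ.≤ c) → lindisc A ≤ fromℚ c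
  lindisc≤ A {c} ≤c = pointwise≤ λ s →
    -- Each `value` is itself a term of `roundingError`, at an index supplied by the Cauchy modulus.
    -- Grid points are constant sequences, so that term of the point lies in the cube.
    foldᵛ⁺-⊔≤ (S.value s) λ v → ≤c (S.grid s v) _ (grid∈cube s v)
    where
    module S = Supremum (roundingError A) (roundingError-lipschitz A)
    grid∈cube : ∀ s v {t} → Cube (at t (S.grid s v))
    grid∈cube s v {t} j = subst Unit (sym (cong (λ r → seq r t) (lookup-map j (S.gridPoint s) v)))
      ( 0≤/ℕ (Fin.toℕ i) s
      , /ℕ-mono (Fin.toℕ i) 1 s 0 (ℕₚ.≤-trans (ℕₚ.≤-reflexive (ℕₚ.*-identityʳ (Fin.toℕ i)))
          (ℕₚ.≤-trans (ℕ.s≤s⁻¹ (Finₚ.toℕ<n i)) (ℕₚ.≤-reflexive (sym (ℕₚ.*-identityˡ (suc s)))))))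
      where i = lookup v j

  -- The bound for monotone matrices and its comparison with the logarithm.

  ι-* : ∀ a b → ι (a ℕ.* b) ≡ ι a ℚ.* ι b
  ι-* zero    b = sym (ℚₚ.*-zeroˡ (ι b))
  ι-* (suc a) b = begin
    ι (b ℕ.+ a ℕ.* b)               ≡⟨ /ℕ-+ b (a ℕ.* b) 0 ⟩
    ι b ℚ.+ ι (a ℕ.* b)             ≡⟨ cong₂ ℚ._+_ (sym (ℚₚ.*-identityˡ (ι b))) (ι-* a b) ⟩
    1ℚ ℚ.* ι b ℚ.+ ι a ℚ.* ι b      ≡⟨ ℚₚ.*-distribʳ-+ (ι b) 1ℚ (ι a) ⟨
    (1ℚ ℚ.+ ι a) ℚ.* ι b            ≡⟨ cong (ℚ._* ι b) (/ℕ-+ 1 a 0) ⟨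
    ι (suc a) ℚ.* ι b               ∎
    where open ≡-Reasoning

  -- Doubling `2 ^ ⌊log₂ N ⌋ ≤ N` gives the power inequality that characterises a lower bound of the
  -- logarithm with denominator 1, which is `q = 0`.
  1+⌊log₂⌋≤log₂ : ∀ N .{{_ : ℕ.NonZero N}} → fromℚ (ι (suc ⌊log₂ N ⌋)) ≤ log₂ (2 ℕ.* N)
  1+⌊log₂⌋≤log₂ N = Equivalence.to (log₂-characterisation (2 ℕ.* N) {{ℕₚ.m*n≢0 2 N}} (suc ⌊log₂ N ⌋) 0)
    (ℕₚ.≤-trans (ℕₚ.*-monoʳ-≤ 2 (2^⌊log₂n⌋≤n N)) (ℕₚ.≤-reflexive (sym (ℕₚ.*-identityʳ (2 ℕ.* N)))))

  ∣∣-mono : ∀ {i j} → + 0 ℤ.≤ i → i ℤ.≤ j → ℤ.∣ i ∣ ℕ.≤ ℤ.∣ j ∣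
  ∣∣-mono (ℤ.+≤+ _) (ℤ.+≤+ i≤j) = i≤j

  lindisc-monotone : ∀ {k n m} .{{_ : ℕ.NonZero k}} (A : Matrix ℤ n m) → k -Monotone A →
    lindisc (map (map fromℤ) A) ≤ fromℚ (ι (suc ⌊log₂ (n ℕ.⊓ m) ⌋ ℕ.* (2 ℕ.* k)))
  lindisc-monotone {k} {n} {m} A (bounds , increasing) = lindisc≤ (map (map fromℤ) A) λ y t y∈ →
    let x , int , near = rounding k B B≤k B-chain l (n<2^[1+⌊log₂n⌋] (n ℕ.⊓ m)) (at t y) y∈
    in seq-roundingError≤ (map (map fromℤ) A) y t x int (0≤/ℕ (l ℕ.* (2 ℕ.* k)) 0) λ i →
         subst₂ (λ p q → ℚ.∣ p ℚ.- q ∣ ℚ.≤ ι (l ℕ.* (2 ℕ.* k)))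
           (·-cong (row t i) λ _ → refl) (·-cong (row t i) λ _ → refl) (near i)
    where
    l = suc ⌊log₂ (n ℕ.⊓ m) ⌋

    -- The entries are nonnegative, so absolute values lose nothing and give the natural numbers
    -- that the weights are built from.
    B : Fin n → Vector ℕ m
    B i j = ℤ.∣ lookup (lookup A i) j ∣

    B≤k : ∀ i j → B i j ℕ.≤ k
    B≤k i j = let 0≤ , ≤k = bounds i j in ∣∣-mono 0≤ ≤k

    -- The columns all increase in the same order of rows, so any two rows are comparable in every
    -- column at once.
    B-chain : ∀ i i′ → Comparable (B i) (B i′)
    B-chain i i′ with Finₚ.≤-total i i′
    ... | inj₁ i≤i′ = inj₁ λ j → ∣∣-mono (proj₁ (bounds i j)) (increasing j i≤i′)
    ... | inj₂ i′≤i = inj₂ λ j → ∣∣-mono (proj₁ (bounds i′ j)) (increasing j i′≤i)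

    row : ∀ t i j → ι (B i j) ≡ at t (lookup (map (map fromℤ) A) i) j
    row t i j = trans (cong (ℚ._/ 1) (ℤₚ.0≤i⇒+∣i∣≡i (proj₁ (bounds i j)))) (sym (cong (λ r → seq r t)
      (trans (cong (λ v → lookup v j) (lookup-map i (map fromℤ) A)) (lookup-map j fromℤ (lookup A i)))))

  doubled-log₂≤ : ∀ k N .{{_ : ℕ.NonZero k}} .{{_ : ℕ.NonZero N}} →
    fromℚ (ι (suc ⌊log₂ N ⌋ ℕ.* (2 ℕ.* k))) ≤ fromℕ 5 * fromℕ k * log₂ (2 ℕ.* N)
  doubled-log₂≤ k N = ≤-trans (fromℚ-mono l*2k≤)
    -- The two `pointwise≤` steps only recast products whose terms coincide; the inequality between
    -- them is the logarithm bound scaled by `5k`.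
    (≤-trans (pointwise≤ {fromℚ (5k ℚ.* ι l)} {fromℚ 5k * fromℚ (ι l)} λ _ → ℚₚ.≤-refl)
      (≤-trans (*-monoˡ-≤ 5k 0<5k (1+⌊log₂⌋≤log₂ N)) (pointwise≤ λ _ → ℚₚ.≤-refl)))
    where
    l = suc ⌊log₂ N ⌋

    5k : ℚ
    5k = ι 5 ℚ.* ι k

    0<5k : 0ℚ ℚ.< 5k
    0<5k = ℚₚ.<-≤-trans (ℚₚ.positive⁻¹ 1ℚ)
      (subst (1ℚ ℚ.≤_) (ι-* 5 k) (ι-mono (ℕ.>-nonZero⁻¹ (5 ℕ.* k) {{ℕₚ.m*n≢0 5 k}})))

    l*2k≤ : ι (l ℕ.* (2 ℕ.* k)) ℚ.≤ 5k ℚ.* ι l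
    l*2k≤ = begin
      -- The rounding yields the constant 2, relaxed here to the stated 5.
      ι (l ℕ.* (2 ℕ.* k))   ≤⟨ ι-mono (ℕₚ.*-monoʳ-≤ l (ℕₚ.*-monoˡ-≤ k (ℕₚ.m≤m+n 2 3))) ⟩
      ι (l ℕ.* (5 ℕ.* k))   ≡⟨ cong ι (ℕₚ.*-comm l (5 ℕ.* k)) ⟩
      ι (5 ℕ.* k ℕ.* l)     ≡⟨ ι-* (5 ℕ.* k) l ⟩
      ι (5 ℕ.* k) ℚ.* ι l   ≡⟨ cong (ℚ._* ι l) (ι-* 5 k) ⟩
      5k ℚ.* ι l            ∎
      where open ℚₚ.≤-Reasoning

open RealBounds

theorem8 : ∀ (k n m : ℕ) → 1 ℕ.≤ k → 1 ℕ.≤ n → 1 ℕ.≤ m →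
    (A : Matrix ℤ n m) → k -Monotone A →
    lindisc (map (map fromℤ) A) ≤ fromℕ 5 * fromℕ k * log₂ (2 ℕ.* (n ℕ.⊓ m))
theorem8 k@(ℕ.suc _) n@(ℕ.suc _) m@(ℕ.suc _) _ _ _ A mono =
  RealLemmas.≤-trans (lindisc-monotone A mono) (doubled-log₂≤ k (n ℕ.⊓ m))
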